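{- Let $d_n$ ($n\ge3$) be the number of staircase diagrams on the Dynkin graph $D_n$, $\overline d_n$ the number of fully supported ones, and $a_n$ the number of staircase diagrams on the path graph with $n$ vertices ($a_0=1$). With $D(t)=\sum_{n\ge3}d_nt^n$, $\overline D(t)=\sum_{n\ge3}\overline d_nt^n$, $A(t)=\sum_{n\ge0}a_nt^n$, $$D(t)=-2t-3t^2+(2t-t^2+t^3)A(t)+(tA(t)+1)\overline D(t).$$
   Context: The graph $D_n$ ($n\ge3$) has vertices $s_1,\dots,s_n$, with edges $s_i\sim s_{i+1}$ for $2\le i\le n-1$ and $s_1\sim s_3$. A staircase diagram on a graph with vertex set $S$ is a poset $(\mathcal D,\preceq)$ of nonempty subsets (blocks) of $S$ (empty diagram allowed) with: (1) each block connected, and if $B$ covers $B'$ then $B\cup B'$ connected; (2) $\mathcal D_s=\{B:s\in B\}$ a chain; (3) if $s\sim t$, $\mathcal D_s\cup\mathcal D_t$ a chain in which $\mathcal D_s,\mathcal D_t$ are saturated subchains; (4) each $B$ is the minimum of some $\mathcal D_s$ and maximum of some $\mathcal D_{s'}$. Fully supported: $\bigcup_B B=S$. -}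

module Defs where

open import Data.Bool using (Bool; true; false; _∧_; _∨_; not; if_then_else_)
open import Data.Nat using (ℕ; zero; suc; _≡ᵇ_; _≤ᵇ_; _∸_) renaming (_+_ to _+ℕ_)
open import Data.Fin using (Fin; zero; suc; toℕ)
open import Data.Vec using (Vec; []; _∷_; lookup; zipWith; tabulate) renaming (map to vmap; _++_ to _++v_)
open import Data.List using (List; []; _∷_; map; concatMap; length; filterᵇ; foldr; upTo)
open import Data.Integer as ℤ using (ℤ; +_; -_)

-- Graphs on the vertex set Fin n (given by a symmetric Boolean adjacency)

Graph : ℕ → Set
Graph n = Fin n → Fin n → Bool

-- vertices s_1,…,s_n are 0,…,n-1
_≡ᶠ_ : ∀ {n} → Fin n → Fin n → Bool
i ≡ᶠ j = toℕ i ≡ᵇ toℕ j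

PathGraph : (n : ℕ) → Graph n
PathGraph n i j = (suc (toℕ i) ≡ᵇ toℕ j) ∨ (suc (toℕ j) ≡ᵇ toℕ i)

-- D_n: s_i ~ s_{i+1} for 2 ≤ i ≤ n-1, and s_1 ~ s_3
-- (0-based: a ~ a+1 for a ≥ 1, and 0 ~ 2)
dEdge : ℕ → ℕ → Bool
dEdge a b = ((1 ≤ᵇ a) ∧ (b ≡ᵇ suc a)) ∨ ((a ≡ᵇ 0) ∧ (b ≡ᵇ 2))

DGraph : (n : ℕ) → Graph n
DGraph n i j = dEdge (toℕ i) (toℕ j) ∨ dEdge (toℕ j) (toℕ i)

allF : ∀ {n} → (Fin n → Bool) → Bool
allF {zero} p = true
allF {suc n} p = p zero ∧ allF (λ i → p (suc i))

anyF : ∀ {n} → (Fin n → Bool) → Bool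
anyF {zero} p = false
anyF {suc n} p = p zero ∨ anyF (λ i → p (suc i))

_⇒ᵇ_ : Bool → Bool → Bool
a ⇒ᵇ b = not a ∨ b

Subset : ℕ → Set
Subset n = Vec Bool n

_∈ᵇ_ : ∀ {n} → Fin n → Subset n → Bool
x ∈ᵇ X = lookup X x

_∪ˢ_ : ∀ {n} → Subset n → Subset n → Subset n
X ∪ˢ Y = zipWith _∨_ X Y

nonemptyᵇ : ∀ {n} → Subset n → Bool
nonemptyᵇ X = anyF (λ x → x ∈ᵇ X)

iter : {A : Set} → ℕ → (A → A) → A → A
iter zero f a = a
iter (suc k) f a = f (iter k f a)

step : ∀ {n} → Graph n → Subset n → Subset n → Subset n
step G X R = tabulate (λ y → (y ∈ᵇ X) ∧ ((y ∈ᵇ R) ∨ anyF (λ z → (z ∈ᵇ R) ∧ G z y)))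

-- vertices reachable from x by a path inside X (n steps suffice)
reach : ∀ {n} → Graph n → Subset n → Fin n → Subset n
reach {n} G X x = iter n (step G X) (tabulate (λ y → (y ≡ᶠ x) ∧ (y ∈ᵇ X)))

connectedᵇ : ∀ {n} → Graph n → Subset n → Bool
connectedᵇ G X = allF (λ x → (x ∈ᵇ X) ⇒ᵇ allF (λ y → (y ∈ᵇ X) ⇒ᵇ (y ∈ᵇ reach G X x)))

pow2 : ℕ → ℕ
pow2 zero = 1
pow2 (suc n) = pow2 n +ℕ pow2 n

subsets : (n : ℕ) → Vec (Subset n) (pow2 n)
subsets zero = [] ∷ []
subsets (suc n) = vmap (false ∷_) (subsets n) ++v vmap (true ∷_) (subsets n)

-- A candidate diagram is a Boolean relation ≼ on the set of all subsets
-- of S (a pow2 n × pow2 n matrix).  The blocks are the subsets B with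
-- B ≼ B; the relation is required to live on the blocks and to be a
-- partial order there.  This encodes exactly a pair (𝒟, ≼).

RelM : ℕ → Set
RelM n = Vec (Vec Bool (pow2 n)) (pow2 n)

module _ {n : ℕ} (G : Graph n) (M : RelM n) where
  private
    I = Fin (pow2 n)
  blk : I → Subset n
  blk i = lookup (subsets n) i

  le : I → I → Bool
  le i j = lookup (lookup M i) j

  isBlk : I → Bool
  isBlk i = le i i

  lt : I → I → Bool
  lt i j = le i j ∧ not (i ≡ᶠ j)

  covers : I → I → Bool
  covers j i = lt i j ∧ not (anyF (λ k → lt i k ∧ lt k j))

  inD : Fin n → I → Bool
  inD s i = isBlk i ∧ (s ∈ᵇ blk i)

  isPoset : Bool
  isPoset =
    allF (λ i → allF (λ j → le i j ⇒ᵇ (isBlk i ∧ isBlk j))) ∧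
    allF (λ i → allF (λ j → (le i j ∧ le j i) ⇒ᵇ (i ≡ᶠ j))) ∧
    allF (λ i → allF (λ j → allF (λ k → (le i j ∧ le j k) ⇒ᵇ le i k)))

  cond1 : Bool
  cond1 =
    allF (λ i → isBlk i ⇒ᵇ (nonemptyᵇ (blk i) ∧ connectedᵇ G (blk i))) ∧
    allF (λ i → allF (λ j → covers j i ⇒ᵇ connectedᵇ G (blk j ∪ˢ blk i)))

  chainD : Fin n → Bool
  chainD s = allF (λ i → allF (λ j → (inD s i ∧ inD s j) ⇒ᵇ (le i j ∨ le j i)))

  cond2 : Bool
  cond2 = allF chainD

  chainU : Fin n → Fin n → Bool
  chainU s t = allF (λ i → allF (λ j →
    ((inD s i ∨ inD t i) ∧ (inD s j ∨ inD t j)) ⇒ᵇ (le i j ∨ le j i)))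

  saturated : Fin n → Fin n → Bool
  saturated s t = allF (λ i → allF (λ j → allF (λ k →
    (inD s i ∧ inD s k ∧ (inD s j ∨ inD t j) ∧ le i j ∧ le j k) ⇒ᵇ inD s j)))

  cond3 : Bool
  cond3 = allF (λ s → allF (λ t →
    G s t ⇒ᵇ (chainU s t ∧ saturated s t ∧ saturated t s)))

  cond4 : Bool
  cond4 = allF (λ i → isBlk i ⇒ᵇ
    (anyF (λ s → inD s i ∧ allF (λ j → inD s j ⇒ᵇ le i j)) ∧
     anyF (λ s → inD s i ∧ allF (λ j → inD s j ⇒ᵇ le j i))))

  isStaircase : Bool
  isStaircase = isPoset ∧ cond1 ∧ cond2 ∧ cond3 ∧ cond4

  fullySupported : Bool
  fullySupported = allF (λ s → anyF (λ i → inD s i))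

vecsOf : {A : Set} → List A → (k : ℕ) → List (Vec A k)
vecsOf xs zero = [] ∷ []
vecsOf xs (suc k) = concatMap (λ x → map (x ∷_) (vecsOf xs k)) xs

allRelM : (n : ℕ) → List (RelM n)
allRelM n = vecsOf (vecsOf (true ∷ false ∷ []) (pow2 n)) (pow2 n)

numStaircase : ∀ {n} → Graph n → ℕ
numStaircase {n} G = length (filterᵇ (isStaircase G) (allRelM n))

numStaircaseFull : ∀ {n} → Graph n → ℕ
numStaircaseFull {n} G =
  length (filterᵇ (λ M → isStaircase G M ∧ fullySupported G M) (allRelM n))

d : ℕ → ℕ
d n = numStaircase (DGraph n)

dbar : ℕ → ℕ
dbar n = numStaircaseFull (DGraph n)

a : ℕ → ℕ
a n = numStaircase (PathGraph n)

Series : Set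
Series = ℕ → ℤ

_⊕_ : Series → Series → Series
(f ⊕ g) n = f n ℤ.+ g n

_⊗_ : Series → Series → Series
(f ⊗ g) n = foldr ℤ._+_ (+ 0) (map (λ k → f k ℤ.* g (n ∸ k)) (upTo (suc n)))

infixl 6 _⊕_
infixl 7 _⊗_

poly : List ℤ → Series
poly [] n = + 0
poly (c ∷ cs) zero = c
poly (c ∷ cs) (suc n) = poly cs n

Dser : Series
Dser n = if 3 ≤ᵇ n then + d n else + 0

Dbarser : Series
Dbarser n = if 3 ≤ᵇ n then + dbar n else + 0

Aser : Series
Aser n = + a n

{-# OPTIONS --safe #-}

-- Sort the diagrams on D_n by their support.  A diagram supported on the union of two vertex sets
-- with no edge between them is the same as a pair of diagrams supported on the two sets: blocks are
-- connected, and so are unions of a block with one covering it, hence comparable blocks lie on the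
-- same side.  Diagrams supported inside a vertex set are the diagrams of the induced subgraph.
-- Missing s_1 or s_2 leaves a path, giving 2 a(n-1) - a(n-2) diagrams by inclusion-exclusion; if
-- s_1, s_2 occur but not s_3, both are singleton blocks and a(n-3) diagrams remain; otherwise let
-- s_(k+1) be the first missing vertex, which contributes dbar k * a(n-1-k), or dbar n if there is none.

module Submission where

open import Defs
open import Data.List using (List; []; _∷_)
open import Data.Integer using (ℤ; +_; -_)
open import Relation.Binary.PropositionalEquality using (_≡_)

open import Data.Bool using (Bool; true; false; _∧_; _∨_)
open import Data.Bool.Properties using (T-≡; T?; ⇔→≡; ∨-identityʳ) renaming (_≟_ to _≟ᵇ_)
open import Data.Empty using (⊥-elim)
open import Data.Fin using (Fin; zero; suc; toℕ; fromℕ<; _≟_; _↑ˡ_; _↑ʳ_; splitAt)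
open import Data.Fin.Induction using (spo-wellFounded; spo-noetherian)
open import Data.Fin.Properties using (any?; all?; toℕ-injective; toℕ-fromℕ<; toℕ<n; splitAt⁻¹-↑ˡ; splitAt⁻¹-↑ʳ)
import Data.Fin.Subset as Fin
open import Data.Fin.Subset.Properties using (p⊂q⇒∣p∣<∣q∣; p⊆q⇒∣p∣≤∣q∣; ∣p∣≤n; ∣⁅x⁆∣≡1; x∈⁅y⁆⇒x≡y; ⊆-antisym)
import Data.Integer as ℤ
import Data.Integer.Properties as ℤₚ
open import Data.Integer.Tactic.RingSolver using (solve-∀)
open import Data.List using (_++_; map; length; filterᵇ; filter; concatMap; cartesianProductWith; cartesianProduct; foldr; applyUpTo)
open import Data.List.Membership.Propositional using (_∈_)
open import Data.List.Membership.Propositional.Properties using (∈-map⁺; ∈-map⁻; ∈-++⁺ˡ; ∈-++⁺ʳ; ∈-++⁻; ∈-filter⁺; ∈-filter⁻; ∈-cartesianProduct⁺; ∈-cartesianProduct⁻; ∈-cartesianProductWith⁺)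
open import Data.List.Membership.Propositional.Properties.WithK using (unique∧set⇒bag)
open import Data.List.Properties using (length-map; length-++; map-upTo)
open import Data.List.Relation.Binary.BagAndSetEquality using (∼bag⇒↭)
open import Data.List.Relation.Binary.Permutation.Propositional.Properties using (↭-length)
open import Data.List.Relation.Unary.All as All using (All; []; _∷_)
import Data.List.Relation.Unary.All.Properties as All
open import Data.List.Relation.Unary.AllPairs using ([]; _∷_)
open import Data.List.Relation.Unary.Any using (here; there)
open import Data.List.Relation.Unary.Unique.Propositional using (Unique)
import Data.List.Relation.Unary.Unique.Propositional.Properties as Unique
open import Data.Nat as ℕ using (ℕ; zero; suc; _+_; _*_; _∸_; _≤_; _<_; _≡ᵇ_; z≤n; s≤s; s<s; s<s⁻¹; z<s)
open import Data.Nat.Properties using (≤-refl; ≤-<-trans; <-≤-trans; <-irrefl; <-trans; <-asym; <-cmp; <⇒≤; <⇒≢; >⇒≢; ≤-reflexive; n<1+n; m≤m+n; m≤n⇒m≤1+n; m≤n⇒m<n∨m≡n; +-identityʳ; +-suc; +-monoʳ-<; +-cancelˡ-≡; +-cancelˡ-<; +-∸-assoc; *-identityˡ; *-comm; m+n∸n≡m; m+[n∸m]≡n; suc-injective; ≡ᵇ⇒≡; ≡⇒≡ᵇ; ≤ᵇ-reflects-≤; _<?_)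
open import Data.Nat.Tactic.RingSolver renaming (solve-∀ to solve-∀ℕ)
open import Data.Product as Product using (∃; _×_; _,_; proj₁; proj₂; uncurry)
open import Data.Sum as Sum using (_⊎_; inj₁; inj₂; [_,_]′)
open import Data.Vec as Vec using (Vec; []; lookup; tabulate)
open import Data.Vec.Properties using (lookup∘tabulate; tabulate∘lookup; tabulate-cong; lookup-zipWith; lookup-map; lookup-++ˡ; lookup-++ʳ; []=⇒lookup; lookup⇒[]=)
open import Function using (_∘_; id; flip; _⇔_; mk⇔; Equivalence)
open import Induction.WellFounded using (Acc; acc)
open import Level using (0ℓ)
open import Relation.Binary using (Rel; IsStrictPartialOrder; tri<; tri≈; tri>) renaming (Decidable to Decidable₂)
open import Relation.Binary.PropositionalEquality using (_≢_; refl; sym; trans; cong; cong₂; subst; isEquivalence; module ≡-Reasoning)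
open import Relation.Nullary using (¬_; Dec; yes; no; ¬?; does; proof; contradiction; _×-dec_; _⊎-dec_; _→-dec_)
open import Relation.Nullary.Decidable using (map′)
open import Relation.Nullary.Reflects using (Reflects; ofʸ; ofⁿ; T-reflects; _×-reflects_; _⊎-reflects_; _→-reflects_; ¬-reflects)
open import Relation.Unary using (Pred; Decidable; _⊆_; _∪_; _∩_; _≐_; ∅; U)

open Equivalence using (to; from)

-- Counting by enumeration

-- The numbers in the theorem count Boolean matrices of size `pow2 n`, so each identification of
-- diagrams has to become an exact bijection of matrices, between different index types when the
-- graph changes. Hence the staircase conditions are restated for arbitrary vertex and index types,
-- transported there, and tied to the matrices only at the end. The sorting starts at `s_3` because
-- removing `s_(k+1)` separates the vertices before it from those after it only for `k` at least 2,
-- the edge from `s_1` to `s_3` passing over `s_2`. For `k = 2` the first part is a pair of isolated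
-- vertices, not a graph counted by the series of `dbar`, which begins in degree 3; this case yields
-- the separate term `t^3 A`. The terms `2t A - t^2 A` are the inclusion-exclusion for `s_1` and
-- `s_2`, and the `t` in `tA + 1` stands for the first missing vertex. The polynomial `-2t - 3t^2`
-- corrects degrees 1 and 2, where the recurrence does not apply.

record Counts {A : Set} (P : Pred A 0ℓ) (n : ℕ) : Set where
  field
    elements : List A
    unique   : Unique elements
    sound    : ∀ {x} → x ∈ elements → P x
    complete : ∀ {x} → P x → x ∈ elements
    size     : length elements ≡ n

open Counts

module _ {A : Set} where

  -- Duplicate-free lists with the same members are permutations of each other. The equations
  -- between counts in `d-recurrence` arise from here, by counting one predicate in two ways.
  counts-unique : {P : Pred A 0ℓ} {m n : ℕ} → Counts P m → Counts P n → m ≡ n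
  counts-unique c c′ = trans (sym (size c)) (trans (↭-length (∼bag⇒↭ (unique∧set⇒bag
    (unique c) (unique c′) (mk⇔ (complete c′ ∘ sound c) (complete c ∘ sound c′))))) (size c′))

  counts-⊎ : {P Q R : Pred A 0ℓ} {m n : ℕ} → Counts P m → Counts Q n →
    (∀ {x} → P x → ¬ Q x) → (∀ {x} → R x ⇔ (P x ⊎ Q x)) → Counts R (m + n)
  counts-⊎ c c′ disjoint R⇔P⊎Q = record
    { elements = elements c ++ elements c′
    ; unique = Unique.++⁺ (unique c) (unique c′) (λ (x∈ , x∈′) → disjoint (sound c x∈) (sound c′ x∈′))
    ; sound = λ x∈ → from R⇔P⊎Q ([ inj₁ ∘ sound c , inj₂ ∘ sound c′ ]′ (∈-++⁻ (elements c) x∈))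
    ; complete = λ r → [ ∈-++⁺ˡ ∘ complete c , ∈-++⁺ʳ (elements c) ∘ complete c′ ]′ (to R⇔P⊎Q r)
    ; size = trans (length-++ (elements c)) (cong₂ _+_ (size c) (size c′))
    }

  counts-filter : {P Q : Pred A 0ℓ} {m : ℕ} → Counts P m → Decidable Q →
    ∃ (Counts (λ x → P x × Q x))
  counts-filter c Q? = _ , record
    { elements = filter Q? (elements c)
    ; unique = Unique.filter⁺ Q? (unique c)
    ; sound = λ x∈ → let x∈′ , q = ∈-filter⁻ Q? x∈ in sound c x∈′ , q
    ; complete = λ (p , q) → ∈-filter⁺ Q? (complete c p) q
    ; size = refl
    }

module _ {A B : Set} where

  length-cartesianProduct : (xs : List A) (ys : List B) →
    length (cartesianProduct xs ys) ≡ length xs * length ys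
  length-cartesianProduct [] ys = refl
  length-cartesianProduct (x ∷ xs) ys = trans (length-++ (map (x ,_) ys))
    (cong₂ _+_ (length-map (x ,_) ys) (length-cartesianProduct xs ys))

  counts-× : {P : Pred A 0ℓ} {Q : Pred B 0ℓ} {m n : ℕ} → Counts P m → Counts Q n →
    Counts (λ (x , y) → P x × Q y) (m * n)
  counts-× c c′ = record
    { elements = cartesianProduct (elements c) (elements c′)
    ; unique = Unique.cartesianProduct⁺ (unique c) (unique c′)
    ; sound = λ xy∈ → let x∈ , y∈ = ∈-cartesianProduct⁻ (elements c) (elements c′) xy∈
                      in sound c x∈ , sound c′ y∈
    ; complete = λ (p , q) → ∈-cartesianProduct⁺ (complete c p) (complete c′ q)
    ; size = trans (length-cartesianProduct (elements c) (elements c′))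
                   (cong₂ _*_ (size c) (size c′))
    }

  private
    map-unique : (f : A → B) (g : B → A) (xs : List A) →
      All (λ x → x ≡ g (f x)) xs → Unique xs → Unique (map f xs)
    map-unique f g [] [] [] = []
    map-unique f g (x ∷ xs) (x≡ ∷ xs≡) (x∉xs ∷ u) =
      All.map⁺ (All.zipWith (λ (x≢y , y≡) fx≡fy → x≢y (trans x≡ (trans (cong g fx≡fy) (sym y≡))))
        (x∉xs , xs≡))
      ∷ map-unique f g xs xs≡ u

  -- The maps are inverse only on `P` and `Q`: cutting an arbitrary matrix down to a subgraph loses
  -- entries, but nothing of a diagram that is supported there.
  counts-bijection : {P : Pred A 0ℓ} {Q : Pred B 0ℓ} {n : ℕ} (f : A → B) (g : B → A) →
    (∀ {x} → P x → Q (f x)) → (∀ {y} → Q y → P (g y)) →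
    (∀ {x} → P x → x ≡ g (f x)) → (∀ {y} → Q y → y ≡ f (g y)) →
    Counts P n → Counts Q n
  counts-bijection {Q = Q} f g P→Q Q→P gf fg c = record
    { elements = map f (elements c)
    ; unique = map-unique f g (elements c) (All.tabulate (gf ∘ sound c)) (unique c)
    ; sound = λ y∈ → let x , x∈ , y≡fx = ∈-map⁻ f y∈ in subst Q (sym y≡fx) (P→Q (sound c x∈))
    ; complete = λ q → subst (_∈ _) (sym (fg q)) (∈-map⁺ f (complete c (Q→P q)))
    ; size = trans (length-map f (elements c)) (size c)
    }

counts-cong : {A : Set} {P Q : Pred A 0ℓ} {n : ℕ} → (∀ {x} → P x ⇔ Q x) → Counts P n → Counts Q n
counts-cong P⇔Q = counts-bijection id id (to P⇔Q) (from P⇔Q) (λ _ → refl) (λ _ → refl)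

counts-filterᵇ : {A : Set} {xs : List A} {p : A → Bool} → Unique xs → (∀ x → x ∈ xs) →
  Counts (λ x → p x ≡ true) (length (filterᵇ p xs))
counts-filterᵇ {xs = xs} {p} xs-unique ∈xs = record
  { elements = filterᵇ p xs
  ; unique = Unique.filter⁺ (T? ∘ p) xs-unique
  ; sound = λ x∈ → to T-≡ (proj₂ (∈-filter⁻ (T? ∘ p) {xs = xs} x∈))
  ; complete = λ px → ∈-filter⁺ (T? ∘ p) (∈xs _) (from T-≡ px)
  ; size = refl
  }

module _ {A : Set} {xs : List A} where

  private
    vecsOf-suc : (ys : List A) (k : ℕ) →
      concatMap (λ x → map (x Vec.∷_) (vecsOf xs k)) ys ≡ cartesianProductWith Vec._∷_ ys (vecsOf xs k)
    vecsOf-suc [] k = refl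
    vecsOf-suc (y ∷ ys) k = cong (map (y Vec.∷_) (vecsOf xs k) ++_) (vecsOf-suc ys k)

  vecsOf-unique : Unique xs → ∀ k → Unique (vecsOf xs k)
  vecsOf-unique u zero = [] ∷ []
  vecsOf-unique u (suc k) = subst Unique (sym (vecsOf-suc xs k))
    (Unique.cartesianProductWith⁺ Vec._∷_ (λ { refl → refl , refl }) u (vecsOf-unique u k))

  vecsOf-complete : (∀ x → x ∈ xs) → ∀ {k} (v : Vec A k) → v ∈ vecsOf xs k
  vecsOf-complete ∈xs Vec.[] = here refl
  vecsOf-complete ∈xs {suc k} (x Vec.∷ v) = subst (_ ∈_) (sym (vecsOf-suc xs k))
    (∈-cartesianProductWith⁺ Vec._∷_ (∈xs x) (vecsOf-complete ∈xs v))

private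
  bools-unique : Unique (true ∷ false ∷ [])
  bools-unique = ((λ ()) ∷ []) ∷ [] ∷ []

  bools-complete : ∀ b → b ∈ true ∷ false ∷ []
  bools-complete true = here refl
  bools-complete false = there (here refl)

allRelM-unique : ∀ n → Unique (allRelM n)
allRelM-unique n = vecsOf-unique (vecsOf-unique bools-unique (pow2 n)) (pow2 n)

allRelM-complete : ∀ n (M : RelM n) → M ∈ allRelM n
allRelM-complete n = vecsOf-complete (vecsOf-complete bools-complete)

-- Staircase diagrams over arbitrary vertex and index types

-- Paths grow at their end, as the sets computed by `step` do, and every vertex on them satisfies
-- `P`.
data Path {V : Set} (G : Rel V 0ℓ) (P : Pred V 0ℓ) (x : V) : V → Set where
  stop : P x → Path G P x x
  snoc : ∀ {y z} → Path G P x y → G y z → P z → Path G P x z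

Connected : {V : Set} → Rel V 0ℓ → Pred V 0ℓ → Set
Connected G P = ∀ {x y} → P x → P y → Path G P x y

path-end : {V : Set} {G : Rel V 0ℓ} {P : Pred V 0ℓ} {x y : V} → Path G P x y → P y
path-end (stop p) = p
path-end (snoc _ _ p) = p

path-invariant : {V : Set} {G : Rel V 0ℓ} {P Q : Pred V 0ℓ} →
  (∀ {x y} → Q x → G x y → P y → Q y) → ∀ {x y} → Path G P x y → Q x → Q y
path-invariant closed (stop _) q = q
path-invariant closed (snoc π g p) q = closed (path-invariant closed π q) g p

module Poset {I : Set} (R : Rel I 0ℓ) where

  Lt : Rel I 0ℓ
  Lt i j = R i j × i ≢ j

  Covers : Rel I 0ℓ
  Covers j i = Lt i j × ¬ ∃ λ k → Lt i k × Lt k j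

open Poset

InD : {V I : Set} → (I → Pred V 0ℓ) → Rel I 0ℓ → V → Pred I 0ℓ
InD mem R s i = R i i × mem i s

Supp : {V I : Set} → (I → Pred V 0ℓ) → Rel I 0ℓ → Pred V 0ℓ
Supp mem R s = ∃ (InD mem R s)

-- As in RelM, the blocks are the indices i with R i i.
record Staircase {V I : Set} (G : Rel V 0ℓ) (mem : I → Pred V 0ℓ) (R : Rel I 0ℓ) : Set where
  D : V → Pred I 0ℓ
  D = InD mem R
  field
    blocks          : ∀ {i j} → R i j → R i i × R j j
    antisym         : ∀ {i j} → R i j → R j i → i ≡ j
    transitive      : ∀ {i j k} → R i j → R j k → R i k
    nonempty        : ∀ {i} → R i i → ∃ (mem i)
    connected       : ∀ {i} → R i i → Connected G (mem i)
    cover-connected : ∀ {i j} → Covers R j i → Connected G (mem j ∪ mem i)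
    chain           : ∀ {s i j} → D s i → D s j → R i j ⊎ R j i
    chain-∪         : ∀ {s t i j} → G s t → (D s ∪ D t) i → (D s ∪ D t) j → R i j ⊎ R j i
    saturation      : ∀ {s t i j k} → G s t ⊎ G t s → D s i → D s k → (D s ∪ D t) j →
                      R i j → R j k → D s j
    minimum         : ∀ {i} → R i i → ∃ λ s → D s i × (∀ {j} → D s j → R i j)
    maximum         : ∀ {i} → R i i → ∃ λ s → D s i × (∀ {j} → D s j → R j i)

-- Transport of staircase diagrams along injections of vertices and indices.

-- The two image fields make transport possible in both directions: a path inside a block never
-- leaves the image of `e`, and no block outside the image of `φ` can come between two images, so
-- covers correspond to covers.
record Embedding {V₁ V₂ I₁ I₂ : Set}
  (G₁ : Rel V₁ 0ℓ) (mem₁ : I₁ → Pred V₁ 0ℓ) (R₁ : Rel I₁ 0ℓ)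
  (G₂ : Rel V₂ 0ℓ) (mem₂ : I₂ → Pred V₂ 0ℓ) (R₂ : Rel I₂ 0ℓ) : Set where
  field
    e           : V₁ → V₂
    φ           : I₁ → I₂
    e-injective : ∀ {x y} → e x ≡ e y → x ≡ y
    φ-injective : ∀ {i j} → φ i ≡ φ j → i ≡ j
    G⇔          : ∀ {x y} → G₁ x y ⇔ G₂ (e x) (e y)
    R⇔          : ∀ {i j} → R₁ i j ⇔ R₂ (φ i) (φ j)
    mem⇔        : ∀ {i x} → mem₁ i x ⇔ mem₂ (φ i) (e x)
    mem-image   : ∀ {i y} → mem₂ (φ i) y → ∃ λ x → e x ≡ y
    R-image     : ∀ {a b} → R₂ a b → (∃ λ i → φ i ≡ a) × (∃ λ j → φ j ≡ b)

  push-path : {P₁ : Pred V₁ 0ℓ} {P₂ : Pred V₂ 0ℓ} → (∀ {x} → P₁ x → P₂ (e x)) →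
    ∀ {x y} → Path G₁ P₁ x y → Path G₂ P₂ (e x) (e y)
  push-path f (stop p) = stop (f p)
  push-path f (snoc π g p) = snoc (push-path f π) (to G⇔ g) (f p)

  -- The end point is a variable `u` with `u ≡ e y`, since matching on `stop` would otherwise have
  -- to unify `e x` with `e y`.
  pull-path : {P₁ : Pred V₁ 0ℓ} {P₂ : Pred V₂ 0ℓ} → (∀ {x} → P₂ (e x) → P₁ x) →
    (∀ {y} → P₂ y → ∃ λ x → e x ≡ y) →
    ∀ {x y u} → Path G₂ P₂ (e x) u → u ≡ e y → Path G₁ P₁ x y
  pull-path f im (stop p) ex≡ey with refl ← e-injective ex≡ey = stop (f p)
  pull-path f im (snoc π g p) refl with w , refl ← im (path-end π) =
    snoc (pull-path f im π refl) (from G⇔ g) (f p)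

  D⇔ : ∀ {s i} → InD mem₁ R₁ s i ⇔ InD mem₂ R₂ (e s) (φ i)
  D⇔ = mk⇔ (λ (b , m) → to R⇔ b , to mem⇔ m) (λ (b , m) → from R⇔ b , from mem⇔ m)

  D∪⇔ : ∀ {s t i} → (InD mem₁ R₁ s ∪ InD mem₁ R₁ t) i ⇔ (InD mem₂ R₂ (e s) ∪ InD mem₂ R₂ (e t)) (φ i)
  D∪⇔ = mk⇔ (Sum.map (to D⇔) (to D⇔)) (Sum.map (from D⇔) (from D⇔))

  D-image : ∀ {s a} → InD mem₂ R₂ s a → (∃ λ x → e x ≡ s) × (∃ λ i → φ i ≡ a)
  D-image (b , m) with i , refl ← proj₁ (R-image b) = mem-image m , i , refl

  lt⇔ : ∀ {i j} → Lt R₁ i j ⇔ Lt R₂ (φ i) (φ j)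
  lt⇔ = mk⇔ (λ (r , i≢j) → to R⇔ r , i≢j ∘ φ-injective) (λ (r , i≢j) → from R⇔ r , i≢j ∘ cong φ)

  covers⇔ : ∀ {i j} → Covers R₁ j i ⇔ Covers R₂ (φ j) (φ i)
  covers⇔ = mk⇔
    (λ (l , none) → to lt⇔ l , λ (k , ik , kj) →
      let k′ , k′≡ = proj₂ (R-image (proj₁ ik)) in
      none (k′ , from lt⇔ (subst (Lt R₂ _) (sym k′≡) ik) , from lt⇔ (subst (λ k → Lt R₂ k _) (sym k′≡) kj)))
    (λ (l , none) → from lt⇔ l , λ (k , ik , kj) → none (φ k , to lt⇔ ik , to lt⇔ kj))

  supp⇔ : ∀ {s} → Supp mem₁ R₁ s ⇔ Supp mem₂ R₂ (e s)
  supp⇔ = mk⇔ (λ (i , d) → φ i , to D⇔ d)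
    (λ (a , d) → let i , φi≡a = proj₂ (D-image d) in i , from D⇔ (subst (InD mem₂ R₂ _) (sym φi≡a) d))

  supp-image : ∀ {s} → Supp mem₂ R₂ s → ∃ λ x → e x ≡ s
  supp-image (_ , d) = proj₁ (D-image d)

  module _ (S : Staircase G₂ mem₂ R₂) where
    private module S = Staircase S

    pullback : Staircase G₁ mem₁ R₁
    pullback = record
      { blocks = λ r → let b , b′ = S.blocks (to R⇔ r) in from R⇔ b , from R⇔ b′
      ; antisym = λ r r′ → φ-injective (S.antisym (to R⇔ r) (to R⇔ r′))
      ; transitive = λ r r′ → from R⇔ (S.transitive (to R⇔ r) (to R⇔ r′))
      ; nonempty = λ b → let _ , m = S.nonempty (to R⇔ b) ; x , ex≡ = mem-image m
                         in x , from mem⇔ (subst (mem₂ _) (sym ex≡) m)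
      ; connected = λ b m m′ → pull-path (from mem⇔) mem-image
          (S.connected (to R⇔ b) (to mem⇔ m) (to mem⇔ m′)) refl
      ; cover-connected = λ c m m′ → pull-path (Sum.map (from mem⇔) (from mem⇔)) [ mem-image , mem-image ]′
          (S.cover-connected (to covers⇔ c) (Sum.map (to mem⇔) (to mem⇔) m) (Sum.map (to mem⇔) (to mem⇔) m′)) refl
      ; chain = λ d d′ → Sum.map (from R⇔) (from R⇔) (S.chain (to D⇔ d) (to D⇔ d′))
      ; chain-∪ = λ g d d′ → Sum.map (from R⇔) (from R⇔) (S.chain-∪ (to G⇔ g) (to D∪⇔ d) (to D∪⇔ d′))
      ; saturation = λ g d d′ d″ r r′ → from D⇔
          (S.saturation (Sum.map (to G⇔) (to G⇔) g) (to D⇔ d) (to D⇔ d′) (to D∪⇔ d″) (to R⇔ r) (to R⇔ r′))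
      ; minimum = λ b → let s , d , min = S.minimum (to R⇔ b) in pull d (λ d′ → from R⇔ (min d′))
      ; maximum = λ b → let s , d , max = S.maximum (to R⇔ b) in pull d (λ d′ → from R⇔ (max d′))
      }
      where
      -- A vertex at which `φ i` is extremal belongs to `φ i`, hence comes from a vertex of the
      -- smaller graph.
      pull : ∀ {s i} {Q : Pred I₁ 0ℓ} → InD mem₂ R₂ s (φ i) → (∀ {j} → InD mem₂ R₂ s (φ j) → Q j) →
        ∃ λ s → InD mem₁ R₁ s i × (∀ {j} → InD mem₁ R₁ s j → Q j)
      pull d f with x , refl ← proj₁ (D-image d) = x , from D⇔ d , λ d′ → f (to D⇔ d′)

  module _ (S : Staircase G₁ mem₁ R₁) where
    private
      module S = Staircase S

      D-of : V₂ → Pred I₂ 0ℓ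
      D-of = InD mem₂ R₂

      blocks′ : ∀ {a b} → R₂ a b → R₂ a a × R₂ b b
      blocks′ r with (i , refl) , (j , refl) ← R-image r =
        let b , b′ = S.blocks (from R⇔ r) in to R⇔ b , to R⇔ b′

      antisym′ : ∀ {a b} → R₂ a b → R₂ b a → a ≡ b
      antisym′ r r′ with (i , refl) , (j , refl) ← R-image r = cong φ (S.antisym (from R⇔ r) (from R⇔ r′))

      transitive′ : ∀ {a b c} → R₂ a b → R₂ b c → R₂ a c
      transitive′ r r′ with (i , refl) , (j , refl) ← R-image r | _ , (k , refl) ← R-image r′ =
        to R⇔ (S.transitive (from R⇔ r) (from R⇔ r′))

      nonempty′ : ∀ {a} → R₂ a a → ∃ (mem₂ a)
      nonempty′ b with (i , refl) , _ ← R-image b =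
        let x , m = S.nonempty (from R⇔ b) in e x , to mem⇔ m

      connected′ : ∀ {a} → R₂ a a → Connected G₂ (mem₂ a)
      connected′ b m m′ with (i , refl) , _ ← R-image b with x , refl ← mem-image m | y , refl ← mem-image m′ =
        push-path (to mem⇔) (S.connected (from R⇔ b) (from mem⇔ m) (from mem⇔ m′))

      cover-connected′ : ∀ {a b} → Covers R₂ b a → Connected G₂ (mem₂ b ∪ mem₂ a)
      cover-connected′ c m m′ with (i , refl) , (j , refl) ← R-image (proj₁ (proj₁ c))
        with x , refl ← [ mem-image , mem-image ]′ m | y , refl ← [ mem-image , mem-image ]′ m′ =
        push-path (Sum.map (to mem⇔) (to mem⇔)) (S.cover-connected (from covers⇔ c)
          (Sum.map (from mem⇔) (from mem⇔) m) (Sum.map (from mem⇔) (from mem⇔) m′))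

      chain′ : ∀ {s a b} → D-of s a → D-of s b → R₂ a b ⊎ R₂ b a
      chain′ d d′ with (x , refl) , (i , refl) ← D-image d | _ , (j , refl) ← D-image d′ =
        Sum.map (to R⇔) (to R⇔) (S.chain (from D⇔ d) (from D⇔ d′))

      minimum′ : ∀ {a} → R₂ a a → ∃ λ s → D-of s a × (∀ {b} → D-of s b → R₂ a b)
      minimum′ {a} b with (i , refl) , _ ← R-image b = let s , d , min = S.minimum (from R⇔ b) in
        e s , to D⇔ d , λ d′ → let _ , φj≡ = proj₂ (D-image d′) in
          subst (R₂ a) φj≡ (to R⇔ (min (from D⇔ (subst (D-of (e s)) (sym φj≡) d′))))

      maximum′ : ∀ {a} → R₂ a a → ∃ λ s → D-of s a × (∀ {b} → D-of s b → R₂ b a)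
      maximum′ {a} b with (i , refl) , _ ← R-image b = let s , d , max = S.maximum (from R⇔ b) in
        e s , to D⇔ d , λ d′ → let _ , φj≡ = proj₂ (D-image d′) in
          subst (λ b → R₂ b a) φj≡ (to R⇔ (max (from D⇔ (subst (D-of (e s)) (sym φj≡) d′))))

    pushforward : Staircase G₂ mem₂ R₂
    pushforward = record
      { blocks = blocks′
      ; antisym = antisym′
      ; transitive = transitive′
      ; nonempty = nonempty′
      ; connected = connected′
      ; cover-connected = cover-connected′
      ; chain = chain′
      ; chain-∪ = λ where
          g (inj₁ d) (inj₁ d′) → chain′ d d′
          g (inj₂ d) (inj₂ d′) → chain′ d d′
          g (inj₁ d) (inj₂ d′) → cross g d d′
          g (inj₂ d) (inj₁ d′) → Sum.swap (cross g d′ d)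
      ; saturation = λ where
          g d d′ (inj₁ d″) r r′ → d″
          g d d′ (inj₂ d″) r r′ → between g d d′ d″ r r′
      ; minimum = minimum′
      ; maximum = maximum′
      }
      where
      cross : ∀ {s t a b} → G₂ s t → D-of s a → D-of t b → R₂ a b ⊎ R₂ b a
      cross g d d′ with (x , refl) , (i , refl) ← D-image d | (y , refl) , (j , refl) ← D-image d′ =
        Sum.map (to R⇔) (to R⇔) (S.chain-∪ (from G⇔ g) (inj₁ (from D⇔ d)) (inj₂ (from D⇔ d′)))
      between : ∀ {s t a b c} → G₂ s t ⊎ G₂ t s → D-of s a → D-of s c → D-of t b → R₂ a b → R₂ b c → D-of s b
      between g d d′ d″ r r′ with (x , refl) , (i , refl) ← D-image d | _ , (k , refl) ← D-image d′
                               | (y , refl) , (j , refl) ← D-image d″ =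
        to D⇔ (S.saturation (Sum.map (from G⇔) (from G⇔) g) (from D⇔ d) (from D⇔ d′) (inj₂ (from D⇔ d″))
          (from R⇔ r) (from R⇔ r′))

module _ {N : ℕ} {R : Rel (Fin N) 0ℓ} (R? : Decidable₂ R)
  (antisym : ∀ {i j} → R i j → R j i → i ≡ j) (transitive : ∀ {i j k} → R i j → R j k → R i k) where

  private
    Lt-isStrictPartialOrder : IsStrictPartialOrder _≡_ (Lt R)
    Lt-isStrictPartialOrder = record
      { isEquivalence = isEquivalence
      ; irrefl = λ { refl (_ , i≢i) → i≢i refl }
      ; trans = λ { (r , _) (r′ , j≢k) → transitive r r′ , λ { refl → j≢k (antisym r′ r) } }
      ; <-resp-≈ = (λ { refl l → l }) , λ { refl l → l }
      }

    lt? : Decidable₂ (Lt R)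
    lt? i j = R? i j ×-dec ¬? (i ≟ j)

  -- In a finite poset every i < j is refined by a chain of covers.
  cover-closed⇒order-closed : {Q : Pred (Fin N) 0ℓ} →
    (∀ {i j} → Covers R j i → Q i → Q j) → ∀ {i j} → R i j → Q i → Q j
  cover-closed⇒order-closed {Q} closed {i} {j} r q with i ≟ j
  ... | yes refl = q
  ... | no i≢j = climb (spo-wellFounded Lt-isStrictPartialOrder j)
                       (spo-noetherian Lt-isStrictPartialOrder i) (r , i≢j) q
    where
    climb : ∀ {i j} → Acc (Lt R) j → Acc (flip (Lt R)) i → Lt R i j → Q i → Q j
    climb {i} {j} (acc below) (acc above) i<j q with any? (λ k → lt? i k ×-dec lt? k j)
    ... | no none = closed (i<j , none) q
    -- Each recursive call shrinks the interval at one end: the inner one lowers the upper end to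
    -- `k`, the outer one raises the lower end to `k`. The two accessibility proofs record this.
    ... | yes (k , i<k , k<j) = climb (acc below) (above i<k) k<j
                                  (climb (below k<j) (acc above) i<k q)

-- Separated vertex sets

Restrict : {V I : Set} → (I → Pred V 0ℓ) → Pred V 0ℓ → Rel I 0ℓ → Rel I 0ℓ
Restrict mem U R i j = R i j × mem i ⊆ U × mem j ⊆ U

-- Edges are excluded in both directions because `G` is an arbitrary relation, not assumed
-- symmetric.
record Separated {V : Set} (G : Rel V 0ℓ) (U W : Pred V 0ℓ) : Set where
  field
    disjoint : ∀ {s} → U s → ¬ W s
    no-edge  : ∀ {s t} → U s → W t → ¬ G s t
    no-edge′ : ∀ {s t} → U s → W t → ¬ G t s

separated-sym : {V : Set} {G : Rel V 0ℓ} {U W : Pred V 0ℓ} → Separated G U W → Separated G W U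
separated-sym sep = record
  { disjoint = flip disjoint ; no-edge = flip no-edge′ ; no-edge′ = flip no-edge }
  where open Separated sep

module _ {V : Set} {N : ℕ} {G : Rel V 0ℓ} {mem : Fin N → Pred V 0ℓ} {R : Rel (Fin N) 0ℓ} {U W : Pred V 0ℓ}
  (R? : Decidable₂ R) (sep : Separated G U W) (S : Staircase G mem R) (supp : Supp mem R ⊆ U ∪ W) where

  private
    module S = Staircase S
    open Separated sep

    -- A path inside `P` that starts in `U` can never step into `W`, as no edge joins the two sets.
    connected-within : {P : Pred V 0ℓ} → Connected G P → P ⊆ U ∪ W → ∀ {x} → P x → U x → P ⊆ U
    connected-within {P} conn P⊆ px ux py = path-invariant step′ (conn px py) ux
      where
      step′ : ∀ {x y} → U x → G x y → P y → U y
      step′ u g p with P⊆ p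
      ... | inj₁ u′ = u′
      ... | inj₂ w = contradiction g (no-edge u w)

    block⊆ : ∀ {i} → R i i → mem i ⊆ U ∪ W
    block⊆ b m = supp (_ , b , m)

  block-within : ∀ {i x} → R i i → mem i x → U x → mem i ⊆ U
  block-within b m u = connected-within (S.connected b) (block⊆ b) m u

  -- The union of a block in `U` with a block covering it is connected and meets `U`, so it stays in
  -- `U`. Lying in `U` is thus inherited along covers, and by finiteness along the whole order.
  up-within : ∀ {i j} → R i j → mem i ⊆ U → mem j ⊆ U
  up-within = cover-closed⇒order-closed R? S.antisym S.transitive {Q = λ i → mem i ⊆ U} λ c i⊆U m →
    let b , b′ = S.blocks (proj₁ (proj₁ c)) ; x , mx = S.nonempty b in
    connected-within (S.cover-connected c) [ block⊆ b′ , block⊆ b ]′ (inj₂ mx) (i⊆U mx) (inj₁ m)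

  restrict-staircase : Staircase G mem (Restrict mem U R)
  restrict-staircase = record
    { blocks = λ (r , u , u′) → let b , b′ = S.blocks r in (b , u , u) , (b′ , u′ , u′)
    ; antisym = λ (r , _) (r′ , _) → S.antisym r r′
    ; transitive = λ (r , u , _) (r′ , _ , u′) → S.transitive r r′ , u , u′
    ; nonempty = S.nonempty ∘ proj₁
    ; connected = S.connected ∘ proj₁
    -- A cover of the restriction is a cover of `R`: a block strictly between would lie above a
    -- block in `U`, hence in `U` itself, and would survive the restriction.
    ; cover-connected = λ (((r , u , u′) , i≢j) , none) → S.cover-connected ((r , i≢j) ,
        λ (k , (r₁ , i≢k) , (r₂ , k≢j)) → let uk = up-within r₁ u in
          none (k , ((r₁ , u , uk) , i≢k) , ((r₂ , uk , u′) , k≢j)))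
    ; chain = λ d@((_ , u , _) , _) d′@((_ , u′ , _) , _) → both u u′ (S.chain (weaken d) (weaken d′))
    ; chain-∪ = λ g d d′ → both (within d) (within d′)
        (S.chain-∪ g (Sum.map weaken weaken d) (Sum.map weaken weaken d′))
    ; saturation = λ g d d′ d″ (r , _ , u) (r′ , _) →
        let b , m = S.saturation g (weaken d) (weaken d′) (Sum.map weaken weaken d″) r r′ in (b , u , u) , m
    ; minimum = λ (b , u , _) → let s , (_ , m) , min = S.minimum b in
        s , ((b , u , u) , m) , λ d@((_ , u′ , _) , _) → min (weaken d) , u , u′
    ; maximum = λ (b , u , _) → let s , (_ , m) , max = S.maximum b in
        s , ((b , u , u) , m) , λ d@((_ , u′ , _) , _) → max (weaken d) , u′ , u
    }
    where
    weaken : ∀ {s} → InD mem (Restrict mem U R) s ⊆ InD mem R s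
    weaken ((b , _) , m) = b , m
    within : ∀ {s t i} → (InD mem (Restrict mem U R) s ∪ InD mem (Restrict mem U R) t) i → mem i ⊆ U
    within (inj₁ ((_ , u , _) , _)) = u
    within (inj₂ ((_ , u , _) , _)) = u
    both : ∀ {i j} → mem i ⊆ U → mem j ⊆ U → R i j ⊎ R j i →
      Restrict mem U R i j ⊎ Restrict mem U R j i
    both u u′ = Sum.map (λ r → r , u , u′) (λ r → r , u′ , u)

module _ {V : Set} {N : ℕ} {G : Rel V 0ℓ} {mem : Fin N → Pred V 0ℓ} {R : Rel (Fin N) 0ℓ} {U W : Pred V 0ℓ}
  (R? : Decidable₂ R) (sep : Separated G U W) (S : Staircase G mem R) (supp : Supp mem R ⊆ U ∪ W) where

  -- Any vertex of the lower block decides the side: connectedness puts the whole lower block there,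
  -- and `up-within` the upper one.
  restrict-cover : ∀ {i j} → R i j ⇔ (Restrict mem U R i j ⊎ Restrict mem W R i j)
  restrict-cover = mk⇔ side [ proj₁ , proj₁ ]′
    where
    side : ∀ {i j} → R i j → Restrict mem U R i j ⊎ Restrict mem W R i j
    side r with b , _ ← Staircase.blocks S r with x , m ← Staircase.nonempty S b with supp (_ , b , m)
    ... | inj₁ u = let i⊆ = block-within R? sep S supp b m u in
                   inj₁ (r , i⊆ , up-within R? sep S supp r i⊆)
    ... | inj₂ w = let i⊆ = block-within R? (separated-sym sep) S (Sum.swap ∘ supp) b m w in
                   inj₂ (r , i⊆ , up-within R? (separated-sym sep) S (Sum.swap ∘ supp) r i⊆)

module _ {V I : Set} {G : Rel V 0ℓ} {mem : I → Pred V 0ℓ} {R₁ R₂ : Rel I 0ℓ} {U W : Pred V 0ℓ}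
  (sep : Separated G U W) (S₁ : Staircase G mem R₁) (S₂ : Staircase G mem R₂)
  (supp₁ : Supp mem R₁ ⊆ U) (supp₂ : Supp mem R₂ ⊆ W) where

  private
    module S₁ = Staircase S₁
    module S₂ = Staircase S₂
    open Separated sep

    R : Rel I 0ℓ
    R i j = R₁ i j ⊎ R₂ i j

    no-common-block : ∀ {i} → R₁ i i → ¬ R₂ i i
    no-common-block b₁ b₂ = let _ , m = S₁.nonempty b₁ in
      disjoint (supp₁ (_ , b₁ , m)) (supp₂ (_ , b₂ , m))

    no-composite : ∀ {i j k} → R₁ i j → ¬ R₂ j k
    no-composite r₁ r₂ = no-common-block (proj₂ (S₁.blocks r₁)) (proj₁ (S₂.blocks r₂))

    no-composite′ : ∀ {i j k} → R₂ i j → ¬ R₁ j k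
    no-composite′ r₂ r₁ = no-common-block (proj₁ (S₁.blocks r₁)) (proj₂ (S₂.blocks r₂))

    split : ∀ {s} → InD mem R s ⊆ InD mem R₁ s ∪ InD mem R₂ s
    split (b , m) = Sum.map (_, m) (_, m) b

    no-common-vertex : ∀ {s i j} → InD mem R₁ s i → ¬ InD mem R₂ s j
    no-common-vertex d₁ d₂ = disjoint (supp₁ (_ , d₁)) (supp₂ (_ , d₂))

    same-vertex₁ : ∀ {s i j} → InD mem R₁ s i → InD mem R s j → InD mem R₁ s j
    same-vertex₁ d₁ d = [ id , ⊥-elim ∘ no-common-vertex d₁ ]′ (split d)

    same-vertex₂ : ∀ {s i j} → InD mem R₂ s i → InD mem R s j → InD mem R₂ s j
    same-vertex₂ d₂ d = [ (λ d₁ → ⊥-elim (no-common-vertex d₁ d₂)) , id ]′ (split d)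

    chain-∪-cross : ∀ {s t i j} → G s t → InD mem R s i → InD mem R t j → R i j ⊎ R j i
    chain-∪-cross g d d′ with split d | split d′
    ... | inj₁ d₁ | inj₁ d₁′ = Sum.map inj₁ inj₁ (S₁.chain-∪ g (inj₁ d₁) (inj₂ d₁′))
    ... | inj₂ d₂ | inj₂ d₂′ = Sum.map inj₂ inj₂ (S₂.chain-∪ g (inj₁ d₂) (inj₂ d₂′))
    ... | inj₁ d₁ | inj₂ d₂ = contradiction g (no-edge (supp₁ (_ , d₁)) (supp₂ (_ , d₂)))
    ... | inj₂ d₂ | inj₁ d₁ = contradiction g (no-edge′ (supp₁ (_ , d₁)) (supp₂ (_ , d₂)))

    chain′ : ∀ {s i j} → InD mem R s i → InD mem R s j → R i j ⊎ R j i
    chain′ d d′ with split d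
    ... | inj₁ d₁ = Sum.map inj₁ inj₁ (S₁.chain d₁ (same-vertex₁ d₁ d′))
    ... | inj₂ d₂ = Sum.map inj₂ inj₂ (S₂.chain d₂ (same-vertex₂ d₂ d′))

    saturation′ : ∀ {s t i j k} → G s t ⊎ G t s → InD mem R s i → InD mem R s k →
      InD mem R t j → R i j → R j k → InD mem R s j
    saturation′ g (_ , m) (_ , m′) (_ , m″) (inj₁ r) (inj₁ r′) =
      let bi , bj = S₁.blocks r ; _ , bk = S₁.blocks r′
          b , m‴ = S₁.saturation g (bi , m) (bk , m′) (inj₂ (bj , m″)) r r′ in inj₁ b , m‴
    saturation′ g (_ , m) (_ , m′) (_ , m″) (inj₂ r) (inj₂ r′) =
      let bi , bj = S₂.blocks r ; _ , bk = S₂.blocks r′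
          b , m‴ = S₂.saturation g (bi , m) (bk , m′) (inj₂ (bj , m″)) r r′ in inj₂ b , m‴
    saturation′ _ _ _ _ (inj₁ r) (inj₂ r′) = ⊥-elim (no-composite r r′)
    saturation′ _ _ _ _ (inj₂ r) (inj₁ r′) = ⊥-elim (no-composite′ r r′)

  -- The chain and saturation conditions speak only of blocks at one vertex or at two adjacent
  -- vertices, and such blocks come from the same diagram. Likewise the blocks at a vertex where a
  -- block is extremal all come from that block's diagram, and nothing can be inserted into a cover.
  union-staircase : Staircase G mem (λ i j → R₁ i j ⊎ R₂ i j)
  union-staircase = record
    { blocks = λ where
        (inj₁ r) → let b , b′ = S₁.blocks r in inj₁ b , inj₁ b′
        (inj₂ r) → let b , b′ = S₂.blocks r in inj₂ b , inj₂ b′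
    ; antisym = λ where
        (inj₁ r) (inj₁ r′) → S₁.antisym r r′
        (inj₂ r) (inj₂ r′) → S₂.antisym r r′
        (inj₁ r) (inj₂ r′) → ⊥-elim (no-composite r r′)
        (inj₂ r) (inj₁ r′) → ⊥-elim (no-composite′ r r′)
    ; transitive = λ where
        (inj₁ r) (inj₁ r′) → inj₁ (S₁.transitive r r′)
        (inj₂ r) (inj₂ r′) → inj₂ (S₂.transitive r r′)
        (inj₁ r) (inj₂ r′) → ⊥-elim (no-composite r r′)
        (inj₂ r) (inj₁ r′) → ⊥-elim (no-composite′ r r′)
    ; nonempty = [ S₁.nonempty , S₂.nonempty ]′
    ; connected = λ { (inj₁ b) → S₁.connected b ; (inj₂ b) → S₂.connected b }
    ; cover-connected = λ where
        ((inj₁ r , i≢j) , none) → S₁.cover-connected ((r , i≢j) ,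
          λ (k , (r₁ , i≢k) , (r₂ , k≢j)) → none (k , (inj₁ r₁ , i≢k) , (inj₁ r₂ , k≢j)))
        ((inj₂ r , i≢j) , none) → S₂.cover-connected ((r , i≢j) ,
          λ (k , (r₁ , i≢k) , (r₂ , k≢j)) → none (k , (inj₂ r₁ , i≢k) , (inj₂ r₂ , k≢j)))
    ; chain = chain′
    ; chain-∪ = λ where
        g (inj₁ d) (inj₁ d′) → chain′ d d′
        g (inj₂ d) (inj₂ d′) → chain′ d d′
        g (inj₁ d) (inj₂ d′) → chain-∪-cross g d d′
        g (inj₂ d) (inj₁ d′) → Sum.swap (chain-∪-cross g d′ d)
    ; saturation = λ where
        g d d′ (inj₁ d″) r r′ → d″
        g d d′ (inj₂ d″) r r′ → saturation′ g d d′ d″ r r′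
    ; minimum = λ where
        (inj₁ b) → let s , d@(_ , m) , min = S₁.minimum b in
          s , (inj₁ b , m) , λ d′ → inj₁ (min (same-vertex₁ d d′))
        (inj₂ b) → let s , d@(_ , m) , min = S₂.minimum b in
          s , (inj₂ b , m) , λ d′ → inj₂ (min (same-vertex₂ d d′))
    ; maximum = λ where
        (inj₁ b) → let s , d@(_ , m) , max = S₁.maximum b in
          s , (inj₁ b , m) , λ d′ → inj₁ (max (same-vertex₁ d d′))
        (inj₂ b) → let s , d@(_ , m) , max = S₂.maximum b in
          s , (inj₂ b , m) , λ d′ → inj₂ (max (same-vertex₂ d d′))
    }

  -- Blocks are nonempty, so a block of `R₂` cannot lie in `U`; without this the empty set would
  -- belong to both sides.
  restrict-union₁ : ∀ {i j} → R₁ i j ⇔ Restrict mem U (λ i j → R₁ i j ⊎ R₂ i j) i j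
  restrict-union₁ = mk⇔
    (λ r → let b , b′ = S₁.blocks r in inj₁ r , (λ {_} m → supp₁ (_ , b , m)) , λ {_} m → supp₁ (_ , b′ , m))
    λ where
      (inj₁ r , _) → r
      (inj₂ r , u , _) → let b = proj₁ (S₂.blocks r) ; _ , m = S₂.nonempty b in
        ⊥-elim (disjoint (u m) (supp₂ (_ , b , m)))

  restrict-union₂ : ∀ {i j} → R₂ i j ⇔ Restrict mem W (λ i j → R₁ i j ⊎ R₂ i j) i j
  restrict-union₂ = mk⇔
    (λ r → let b , b′ = S₂.blocks r in inj₂ r , (λ {_} m → supp₂ (_ , b , m)) , λ {_} m → supp₂ (_ , b′ , m))
    λ where
      (inj₂ r , _) → r
      (inj₁ r , w , _) → let b = proj₁ (S₁.blocks r) ; _ , m = S₁.nonempty b in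
        ⊥-elim (disjoint (supp₁ (_ , b , m)) (w m))

-- Reflection of the Boolean definitions

reflects-true : ∀ {b} {P : Set} → Reflects P b → b ≡ true ⇔ P
reflects-true (ofʸ p) = mk⇔ (λ _ → p) (λ _ → refl)
reflects-true (ofⁿ ¬p) = mk⇔ (λ ()) (λ p → contradiction p ¬p)

reflects-map : ∀ {b} {P Q : Set} → P ⇔ Q → Reflects P b → Reflects Q b
reflects-map P⇔Q (ofʸ p) = ofʸ (to P⇔Q p)
reflects-map P⇔Q (ofⁿ ¬p) = ofⁿ (¬p ∘ from P⇔Q)

≡true-reflects : ∀ b → Reflects (b ≡ true) b
≡true-reflects true = ofʸ refl
≡true-reflects false = ofⁿ λ ()

allF-reflects : ∀ {n} {p : Fin n → Bool} {P : Pred (Fin n) 0ℓ} →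
  (∀ i → Reflects (P i) (p i)) → Reflects (∀ i → P i) (allF p)
allF-reflects {zero} r = ofʸ λ ()
allF-reflects {suc n} r = reflects-map
  (mk⇔ (λ { (p , ps) zero → p ; (p , ps) (suc i) → ps i }) (λ ps → ps zero , ps ∘ suc))
  (r zero ×-reflects allF-reflects (r ∘ suc))

anyF-reflects : ∀ {n} {p : Fin n → Bool} {P : Pred (Fin n) 0ℓ} →
  (∀ i → Reflects (P i) (p i)) → Reflects (∃ P) (anyF p)
anyF-reflects {zero} r = ofⁿ λ ()
anyF-reflects {suc n} r = reflects-map
  (mk⇔ [ (zero ,_) , Product.map suc id ]′ (λ { (zero , p) → inj₁ p ; (suc i , p) → inj₂ (i , p) }))
  (r zero ⊎-reflects anyF-reflects (r ∘ suc))

≡ᶠ-reflects : ∀ {n} (i j : Fin n) → Reflects (i ≡ j) (i ≡ᶠ j)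
≡ᶠ-reflects i j = reflects-map
  (mk⇔ (toℕ-injective ∘ ≡ᵇ⇒≡ (toℕ i) (toℕ j)) (≡⇒≡ᵇ (toℕ i) (toℕ j) ∘ cong toℕ))
  (T-reflects (i ≡ᶠ j))

_∈ˢ_ : ∀ {n} → Fin n → Subset n → Set
x ∈ˢ X = lookup X x ≡ true

tabulate-∈ˢ : ∀ {n} {p : Fin n → Bool} {P : Pred (Fin n) 0ℓ} →
  (∀ x → Reflects (P x) (p x)) → ∀ x → x ∈ˢ tabulate p ⇔ P x
tabulate-∈ˢ {p = p} r x = reflects-true (subst (Reflects _) (sym (lookup∘tabulate p x)) (r x))

Adj : ∀ {n} → Graph n → Rel (Fin n) 0ℓ
Adj G x y = G x y ≡ true

module _ {n : ℕ} (G : Graph n) (X : Subset n) where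

  private
    step-∈ˢ : ∀ R y → y ∈ˢ step G X R ⇔ (y ∈ˢ X × (y ∈ˢ R ⊎ ∃ λ z → z ∈ˢ R × Adj G z y))
    step-∈ˢ R = tabulate-∈ˢ λ y → ≡true-reflects (y ∈ᵇ X) ×-reflects (≡true-reflects (y ∈ᵇ R) ⊎-reflects
      anyF-reflects λ z → ≡true-reflects (z ∈ᵇ R) ×-reflects ≡true-reflects (G z y))

    module _ (x : Fin n) where

      reached : ℕ → Subset n
      reached k = iter k (step G X) (tabulate (λ y → (y ≡ᶠ x) ∧ (y ∈ᵇ X)))

      reached-zero : ∀ y → y ∈ˢ reached 0 ⇔ (y ≡ x × y ∈ˢ X)
      reached-zero = tabulate-∈ˢ λ y → ≡ᶠ-reflects y x ×-reflects ≡true-reflects (y ∈ᵇ X)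

      reached⇒path : ∀ k y → y ∈ˢ reached k → Path (Adj G) (_∈ˢ X) x y
      reached⇒path zero y y∈ with refl , y∈X ← to (reached-zero y) y∈ = stop y∈X
      reached⇒path (suc k) y y∈ with to (step-∈ˢ (reached k) y) y∈
      ... | _ , inj₁ y∈R = reached⇒path k y y∈R
      ... | y∈X , inj₂ (z , z∈R , g) = snoc (reached⇒path k z z∈R) g y∈X

      reached-mono : ∀ k y → y ∈ˢ reached k → y ∈ˢ reached (suc k)
      reached-mono k y y∈ = from (step-∈ˢ (reached k) y) (path-end (reached⇒path k y y∈) , inj₁ y∈)

      reached-⊆ : ∀ k → reached k Fin.⊆ reached (suc k)
      reached-⊆ k y∈ = lookup⇒[]= _ (reached (suc k)) (reached-mono k _ ([]=⇒lookup y∈))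

      module _ (x∈X : x ∈ˢ X) where

        -- Until it stabilises, the reached set gains a vertex at every step, so n steps suffice.
        stable-or-growing : ∀ k → reached (suc k) ≡ reached k ⊎ k < Fin.∣ reached k ∣
        stable-or-growing zero = inj₂ (subst (_≤ Fin.∣ reached 0 ∣) (∣⁅x⁆∣≡1 x)
          (p⊆q⇒∣p∣≤∣q∣ {p = Fin.⁅ x ⁆} {q = reached 0} λ {y} y∈ →
            lookup⇒[]= y (reached 0) (from (reached-zero y) (x∈⁅y⁆⇒x≡y x y∈ ,
              subst (_∈ˢ X) (sym (x∈⁅y⁆⇒x≡y x y∈)) x∈X))))
        stable-or-growing (suc k) with stable-or-growing k
        ... | inj₁ stable = inj₁ (cong (step G X) stable)
        ... | inj₂ k<∣R∣ with any? (λ y → (lookup (reached (suc k)) y ≟ᵇ true) ×-dec ¬? (lookup (reached k) y ≟ᵇ true))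
        ...   | yes (y , y∈ , y∉) = inj₂ (≤-<-trans k<∣R∣ (p⊂q⇒∣p∣<∣q∣ {p = reached k} {q = reached (suc k)}
                  (reached-⊆ k , y , lookup⇒[]= y (reached (suc k)) y∈ , y∉ ∘ []=⇒lookup)))
        ...   | no none = inj₁ (cong (step G X) (⊆-antisym
                  (λ {y} y∈ → lookup⇒[]= y (reached k) (old y ([]=⇒lookup y∈))) (reached-⊆ k)))
          where
          old : ∀ y → y ∈ˢ reached (suc k) → y ∈ˢ reached k
          old y y∈ with lookup (reached k) y ≟ᵇ true
          ... | yes y∈R = y∈R
          ... | no y∉R = contradiction (y , y∈ , y∉R) none

        stable : reached (suc n) ≡ reached n
        stable = [ id , (λ n<∣R∣ → contradiction (<-≤-trans n<∣R∣ (∣p∣≤n (reached n))) (<-irrefl refl)) ]′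
          (stable-or-growing n)

        start-reached : ∀ k → x ∈ˢ reached k
        start-reached zero = from (reached-zero x) (refl , x∈X)
        start-reached (suc k) = reached-mono k x (start-reached k)

        -- The step count stays `n` throughout the induction, whatever the length of the path,
        -- because by `stable` a further `step` adds nothing.
        path⇒reached : ∀ {y} → Path (Adj G) (_∈ˢ X) x y → y ∈ˢ reached n
        path⇒reached (stop _) = start-reached n
        path⇒reached (snoc {y} {z} π g z∈X) =
          subst (z ∈ˢ_) stable (from (step-∈ˢ (reached n) z) (z∈X , inj₂ (y , path⇒reached π , g)))

    AllReached : Set
    AllReached = ∀ x → x ∈ˢ X → ∀ y → y ∈ˢ X → y ∈ˢ reach G X x

    all-reached⇒connected : AllReached → Connected (Adj G) (_∈ˢ X)
    all-reached⇒connected f x∈ y∈ = reached⇒path _ n _ (f _ x∈ _ y∈)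

    connected⇒all-reached : Connected (Adj G) (_∈ˢ X) → AllReached
    connected⇒all-reached c x x∈ y y∈ = path⇒reached x x∈ (c x∈ y∈)

  connectedᵇ-reflects : Reflects (Connected (Adj G) (_∈ˢ X)) (connectedᵇ G X)
  connectedᵇ-reflects = reflects-map
    (mk⇔ all-reached⇒connected connected⇒all-reached)
    (allF-reflects λ x → ≡true-reflects _ →-reflects
      allF-reflects λ y → ≡true-reflects _ →-reflects ≡true-reflects _)

connected-cong : {V : Set} {G : Rel V 0ℓ} {P Q : Pred V 0ℓ} → (∀ {x} → P x ⇔ Q x) →
  Connected G P ⇔ Connected G Q
connected-cong {G = G} P⇔Q = mk⇔ (transfer (to P⇔Q) (from P⇔Q)) (transfer (from P⇔Q) (to P⇔Q))
  where
  path-map : ∀ {P Q} → P ⊆ Q → ∀ {x y} → Path G P x y → Path G Q x y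
  path-map f (stop p) = stop (f p)
  path-map f (snoc π g p) = snoc (path-map f π) g (f p)
  transfer : ∀ {P Q} → P ⊆ Q → Q ⊆ P → Connected G P → Connected G Q
  transfer f f′ c q q′ = path-map f (c (f′ q) (f′ q′))

-- Predicates and relations encoded by subset indices and Boolean matrices.

Mem : ∀ {n} → Fin (pow2 n) → Pred (Fin n) 0ℓ
Mem {n} i x = x ∈ˢ lookup (subsets n) i

⟦_⟧ : ∀ {k} → Vec (Vec Bool k) k → Rel (Fin k) 0ℓ
⟦ M ⟧ i j = lookup (lookup M i) j ≡ true

⟦_⟧? : ∀ {k} (M : Vec (Vec Bool k) k) → Decidable₂ ⟦ M ⟧
⟦ M ⟧? i j = lookup (lookup M i) j ≟ᵇ true

lookup-ext : {A : Set} {n : ℕ} {u v : Vec A n} → (∀ i → lookup u i ≡ lookup v i) → u ≡ v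
lookup-ext eq = trans (sym (tabulate∘lookup _)) (trans (tabulate-cong eq) (tabulate∘lookup _))

private
  -- The position of a subset in `subsets n`, which lists the sets without the first vertex before
  -- those with it.
  index : ∀ {n} → Subset n → Fin (pow2 n)
  index [] = zero
  index {suc n} (false Vec.∷ X) = index X ↑ˡ pow2 n
  index {suc n} (true Vec.∷ X) = pow2 n ↑ʳ index X

  lookup-index : ∀ {n} (X : Subset n) → lookup (subsets n) (index X) ≡ X
  lookup-index [] = refl
  lookup-index {suc n} (false Vec.∷ X) = trans
    (lookup-++ˡ (Vec.map (false Vec.∷_) (subsets n)) (Vec.map (true Vec.∷_) (subsets n)) (index X))
    (trans (lookup-map (index X) (false Vec.∷_) (subsets n)) (cong (false Vec.∷_) (lookup-index X)))
  lookup-index {suc n} (true Vec.∷ X) = trans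
    (lookup-++ʳ (Vec.map (false Vec.∷_) (subsets n)) (Vec.map (true Vec.∷_) (subsets n)) (index X))
    (trans (lookup-map (index X) (true Vec.∷_) (subsets n)) (cong (true Vec.∷_) (lookup-index X)))

  index-surjective : ∀ n (i : Fin (pow2 n)) → ∃ λ (X : Subset n) → index X ≡ i
  index-surjective zero zero = [] , refl
  index-surjective (suc n) i with splitAt (pow2 n) i in eq
  ... | inj₁ j = let X , index≡ = index-surjective n j in
                 false Vec.∷ X , trans (cong (_↑ˡ pow2 n) index≡) (splitAt⁻¹-↑ˡ eq)
  ... | inj₂ j = let X , index≡ = index-surjective n j in
                 true Vec.∷ X , trans (cong (pow2 n ↑ʳ_) index≡) (splitAt⁻¹-↑ʳ eq)

subset : ∀ {n} {P : Pred (Fin n) 0ℓ} → Decidable P → Fin (pow2 n)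
subset P? = index (tabulate (does ∘ P?))

Mem-subset : ∀ {n} {P : Pred (Fin n) 0ℓ} (P? : Decidable P) {x} → Mem (subset P?) x ⇔ P x
Mem-subset {n} P? {x} = subst (λ X → x ∈ˢ X ⇔ _) (sym (lookup-index (tabulate (does ∘ P?))))
  (tabulate-∈ˢ (proof ∘ P?) x)

-- Every position is the `index` of some set, and that set is read off again at it; hence
-- `subsets n` has no repetitions, and a relation on positions is the same as a relation on sets.
Mem-ext : ∀ {n} {i j : Fin (pow2 n)} → (∀ {x} → Mem {n} i x ⇔ Mem j x) → i ≡ j
Mem-ext {n} {i} {j} eq with X , refl ← index-surjective n i | Y , refl ← index-surjective n j =
  cong (index {n}) {x = X} {y = Y} (lookup-ext λ x → trans (cong (λ Z → lookup Z x) (sym (lookup-index X)))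
    (trans (⇔→≡ eq) (cong (λ Z → lookup Z x) (lookup-index Y))))

relation : ∀ {k} {R : Rel (Fin k) 0ℓ} → Decidable₂ R → Vec (Vec Bool k) k
relation R? = tabulate λ i → tabulate λ j → does (R? i j)

⟦relation⟧ : ∀ {k} {R : Rel (Fin k) 0ℓ} (R? : Decidable₂ R) {i j} → ⟦ relation R? ⟧ i j ⇔ R i j
⟦relation⟧ R? {i} {j} = subst (λ v → lookup v j ≡ true ⇔ _)
  (sym (lookup∘tabulate (λ i → tabulate λ j → does (R? i j)) i)) (tabulate-∈ˢ (proof ∘ R? i) j)

⟦⟧-ext : ∀ {k} {M M′ : Vec (Vec Bool k) k} → (∀ {i j} → ⟦ M ⟧ i j ⇔ ⟦ M′ ⟧ i j) → M ≡ M′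
⟦⟧-ext eq = lookup-ext λ i → lookup-ext λ j → ⇔→≡ eq

Diagram : ∀ {n} → Graph n → Pred (RelM n) 0ℓ
Diagram {n} G M = Staircase (Adj G) (Mem {n}) ⟦ M ⟧

Support : ∀ {n} → RelM n → Pred (Fin n) 0ℓ
Support {n} M = Supp (Mem {n}) ⟦ M ⟧

module _ {n : ℕ} (G : Graph n) (M : RelM n) where

  private
    I = Fin (pow2 n)

    R : Rel I 0ℓ
    R = ⟦ M ⟧

    D : Fin n → Pred I 0ℓ
    D = InD Mem R

    le-reflects : ∀ i j → Reflects (R i j) (le G M i j)
    le-reflects i j = ≡true-reflects _

    mem-reflects : ∀ s i → Reflects (Mem i s) (s ∈ᵇ blk G M i)
    mem-reflects s i = ≡true-reflects _

    inD-reflects : ∀ s i → Reflects (D s i) (inD G M s i)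
    inD-reflects s i = le-reflects i i ×-reflects mem-reflects s i

    lt-reflects : ∀ i j → Reflects (Lt R i j) (lt G M i j)
    lt-reflects i j = le-reflects i j ×-reflects ¬-reflects (≡ᶠ-reflects i j)

    covers-reflects : ∀ j i → Reflects (Covers R j i) (covers G M j i)
    covers-reflects j i = lt-reflects i j ×-reflects
      ¬-reflects (anyF-reflects λ k → lt-reflects i k ×-reflects lt-reflects k j)

    ∪-reflects : ∀ i j → Reflects (Connected (Adj G) (Mem j ∪ Mem i)) (connectedᵇ G (blk G M j ∪ˢ blk G M i))
    ∪-reflects i j = reflects-map (connected-cong λ {x} → reflects-true
      (subst (Reflects _) (sym (lookup-zipWith _∨_ x (blk G M j) (blk G M i)))
        (mem-reflects x j ⊎-reflects mem-reflects x i)))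
      (connectedᵇ-reflects G (blk G M j ∪ˢ blk G M i))

    chain-reflects : ∀ {P : Pred I 0ℓ} {p : I → Bool} → (∀ i → Reflects (P i) (p i)) →
      Reflects (∀ i j → P i × P j → R i j ⊎ R j i)
        (allF λ i → allF λ j → (p i ∧ p j) ⇒ᵇ (le G M i j ∨ le G M j i))
    chain-reflects r = allF-reflects λ i → allF-reflects λ j →
      (r i ×-reflects r j) →-reflects (le-reflects i j ⊎-reflects le-reflects j i)

    saturated-reflects : ∀ s t → Reflects
      (∀ i j k → D s i × D s k × (D s ∪ D t) j × R i j × R j k → D s j) (saturated G M s t)
    saturated-reflects s t = allF-reflects λ i → allF-reflects λ j → allF-reflects λ k →
      (inD-reflects s i ×-reflects inD-reflects s k ×-reflects
       (inD-reflects s j ⊎-reflects inD-reflects t j) ×-reflects le-reflects i j ×-reflects le-reflects j k)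
      →-reflects inD-reflects s j

    isPoset-reflects : Reflects
      ((∀ i j → R i j → R i i × R j j) × (∀ i j → R i j × R j i → i ≡ j) × (∀ i j k → R i j × R j k → R i k))
      (isPoset G M)
    isPoset-reflects =
      (allF-reflects λ i → allF-reflects λ j →
        le-reflects i j →-reflects (le-reflects i i ×-reflects le-reflects j j)) ×-reflects
      (allF-reflects λ i → allF-reflects λ j →
        (le-reflects i j ×-reflects le-reflects j i) →-reflects ≡ᶠ-reflects i j) ×-reflects
      (allF-reflects λ i → allF-reflects λ j → allF-reflects λ k →
        (le-reflects i j ×-reflects le-reflects j k) →-reflects le-reflects i k)

    cond1-reflects : Reflects
      ((∀ i → R i i → ∃ (Mem {n} i) × Connected (Adj G) (Mem i)) ×
       (∀ i j → Covers R j i → Connected (Adj G) (Mem j ∪ Mem i)))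
      (cond1 G M)
    cond1-reflects =
      (allF-reflects λ i → le-reflects i i →-reflects
        ((anyF-reflects λ x → mem-reflects x i) ×-reflects connectedᵇ-reflects G (blk G M i))) ×-reflects
      (allF-reflects λ i → allF-reflects λ j → covers-reflects j i →-reflects ∪-reflects i j)

    cond3-reflects : Reflects
      (∀ s t → Adj G s t → (∀ i j → (D s ∪ D t) i × (D s ∪ D t) j → R i j ⊎ R j i) ×
        (∀ i j k → D s i × D s k × (D s ∪ D t) j × R i j × R j k → D s j) ×
        (∀ i j k → D t i × D t k × (D t ∪ D s) j × R i j × R j k → D t j))
      (cond3 G M)
    cond3-reflects = allF-reflects λ s → allF-reflects λ t → ≡true-reflects (G s t) →-reflects
      (chain-reflects (λ i → inD-reflects s i ⊎-reflects inD-reflects t i) ×-reflects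
       saturated-reflects s t ×-reflects saturated-reflects t s)

    cond4-reflects : Reflects
      (∀ i → R i i → (∃ λ s → D s i × (∀ j → D s j → R i j)) × (∃ λ s → D s i × (∀ j → D s j → R j i)))
      (cond4 G M)
    cond4-reflects = allF-reflects λ i → le-reflects i i →-reflects
      ((anyF-reflects λ s → inD-reflects s i ×-reflects
          allF-reflects λ j → inD-reflects s j →-reflects le-reflects i j) ×-reflects
       (anyF-reflects λ s → inD-reflects s i ×-reflects
          allF-reflects λ j → inD-reflects s j →-reflects le-reflects j i))

    Conditions : Set
    Conditions =
      ((∀ i j → R i j → R i i × R j j) × (∀ i j → R i j × R j i → i ≡ j) × (∀ i j k → R i j × R j k → R i k)) ×
      ((∀ i → R i i → ∃ (Mem {n} i) × Connected (Adj G) (Mem i)) ×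
       (∀ i j → Covers R j i → Connected (Adj G) (Mem j ∪ Mem i))) ×
      (∀ s i j → D s i × D s j → R i j ⊎ R j i) ×
      (∀ s t → Adj G s t → (∀ i j → (D s ∪ D t) i × (D s ∪ D t) j → R i j ⊎ R j i) ×
        (∀ i j k → D s i × D s k × (D s ∪ D t) j × R i j × R j k → D s j) ×
        (∀ i j k → D t i × D t k × (D t ∪ D s) j × R i j × R j k → D t j)) ×
      (∀ i → R i i → (∃ λ s → D s i × (∀ j → D s j → R i j)) × (∃ λ s → D s i × (∀ j → D s j → R j i)))

    conditions⇒diagram : Conditions → Diagram G M
    conditions⇒diagram ((blocks , antisym , trans) , (block , cover) , chain , edge , extremal) = record
      { blocks = blocks _ _
      ; antisym = λ r r′ → antisym _ _ (r , r′)
      ; transitive = λ r r′ → trans _ _ _ (r , r′)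
      ; nonempty = λ {i} b → proj₁ (block i b)
      ; connected = λ {i} b → proj₂ (block i b)
      ; cover-connected = cover _ _
      ; chain = λ d d′ → chain _ _ _ (d , d′)
      ; chain-∪ = λ g d d′ → proj₁ (edge _ _ g) _ _ (d , d′)
      ; saturation = λ where
          -- For an ordered edge `cond3` supplies saturation at both of its ends; an edge read
          -- backwards uses the second.
          (inj₁ g) d d′ d″ r r′ → proj₁ (proj₂ (edge _ _ g)) _ _ _ (d , d′ , d″ , r , r′)
          (inj₂ g) d d′ d″ r r′ → proj₂ (proj₂ (edge _ _ g)) _ _ _ (d , d′ , d″ , r , r′)
      ; minimum = λ b → let s , d , min = proj₁ (extremal _ b) in s , d , min _
      ; maximum = λ b → let s , d , max = proj₂ (extremal _ b) in s , d , max _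
      }

    diagram⇒conditions : Diagram G M → Conditions
    diagram⇒conditions S =
      ((λ _ _ → blocks) , (λ _ _ (r , r′) → antisym r r′) , (λ _ _ _ (r , r′) → transitive r r′)) ,
      ((λ _ b → nonempty b , connected b) , λ _ _ → cover-connected) ,
      (λ _ _ _ (d , d′) → chain d d′) ,
      (λ _ _ g → (λ _ _ (d , d′) → chain-∪ g d d′) ,
        (λ _ _ _ (d , d′ , d″ , r , r′) → saturation (inj₁ g) d d′ d″ r r′) ,
        (λ _ _ _ (d , d′ , d″ , r , r′) → saturation (inj₂ g) d d′ d″ r r′)) ,
      (λ _ b → (let s , d , min = minimum b in s , d , λ _ → min) ,
               (let s , d , max = maximum b in s , d , λ _ → max))
      where open Staircase S

  isStaircase-reflects : Reflects (Diagram G M) (isStaircase G M)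
  isStaircase-reflects = reflects-map (mk⇔ conditions⇒diagram diagram⇒conditions)
    (isPoset-reflects ×-reflects cond1-reflects ×-reflects
      (allF-reflects λ s → chain-reflects (inD-reflects s)) ×-reflects cond3-reflects ×-reflects cond4-reflects)

  fullySupported-reflects : Reflects (∀ s → Support M s) (fullySupported G M)
  fullySupported-reflects = allF-reflects λ s → anyF-reflects λ i → inD-reflects s i

Support? : ∀ {n} (M : RelM n) → Decidable (Support {n} M)
Support? {n} M s = any? λ i → ⟦ M ⟧? i i ×-dec (lookup (lookup (subsets n) i) s ≟ᵇ true)

-- Diagrams with support between two bounds

-- One family for all counts: the bounds `∅` and `U` give `a` and `d`, the bounds `U` and `U` give
-- `dbar`. Deciding about a vertex either adds it to `L` or removes it from `H`.
record Between {n : ℕ} (G : Graph n) (L H : Pred (Fin n) 0ℓ) (R : Rel (Fin (pow2 n)) 0ℓ) : Set where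
  constructor between
  field
    staircase : Staircase (Adj G) (Mem {n}) R
    lower     : L ⊆ Supp (Mem {n}) R
    upper     : Supp (Mem {n}) R ⊆ H

open Between

BetweenM : {n : ℕ} → Graph n → (L H : Pred (Fin n) 0ℓ) → Pred (RelM n) 0ℓ
BetweenM G L H M = Between G L H ⟦ M ⟧

-- A record, so that comparing two such types never unfolds the matrices of size pow2 n.
record CountsBetween {n : ℕ} (G : Graph n) (L H : Pred (Fin n) 0ℓ) (k : ℕ) : Set where
  constructor wrap
  field unwrap : Counts (BetweenM G L H) k

open CountsBetween

counts-all : ∀ {n} (G : Graph n) → CountsBetween G ∅ U (numStaircase G)
counts-all {n} G = wrap (counts-cong
  (λ {M} → let r = reflects-true (isStaircase-reflects G M) in
    mk⇔ (λ b → between (to r b) (λ ()) (λ _ → _)) (λ B → from r (staircase B)))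
  (counts-filterᵇ (allRelM-unique n) (allRelM-complete n)))

counts-full : ∀ {n} (G : Graph n) → CountsBetween G U U (numStaircaseFull G)
counts-full {n} G = wrap (counts-cong
  (λ {M} → let r = reflects-true (isStaircase-reflects G M ×-reflects fullySupported-reflects G M) in
    mk⇔ (λ b → let S , full = to r b in between S (λ {s} _ → full s) (λ _ → _))
        (λ B → from r (staircase B , λ s → lower B _)))
  (counts-filterᵇ (allRelM-unique n) (allRelM-complete n)))

module _ {n : ℕ} {G : Graph n} where

  counts-≐ : ∀ {L L′ H H′ k} → L ≐ L′ → H ≐ H′ → CountsBetween G L H k → CountsBetween G L′ H′ k
  counts-≐ (L⊆ , L⊇) (H⊆ , H⊇) (wrap c) = wrap (counts-cong (mk⇔
    (λ (between S l h) → between S (l ∘ L⊇) (H⊆ ∘ h)) (λ (between S l h) → between S (l ∘ L⊆) (H⊇ ∘ h))) c)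

  countsBetween-unique : ∀ {L H j k} → CountsBetween G L H j → CountsBetween G L H k → j ≡ k
  countsBetween-unique (wrap c) (wrap c′) = counts-unique c c′

  module _ {L H : Pred (Fin n) 0ℓ} (s : Fin n) where

    -- Only the existence of the count matters: it provides the auxiliary number `x` of
    -- `d-recurrence`, which is eliminated there.
    counts-containing : ∀ {k} → CountsBetween G L H k → ∃ (CountsBetween G (L ∪ (_≡ s)) H)
    counts-containing (wrap c) = let k , c′ = counts-filter c (λ M → Support? M s) in k , wrap (counts-cong (mk⇔
      (λ (between S l h , ∋s) → between S [ l , (λ { refl → ∋s }) ]′ h)
      (λ (between S l h) → between S (l ∘ inj₁) h , l (inj₂ refl))) c′)

    counts-partition : ∀ {p q} → CountsBetween G (L ∪ (_≡ s)) H p →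
      CountsBetween G L (H ∩ (_≢ s)) q → CountsBetween G L H (p + q)
    counts-partition (wrap c) (wrap c′) = wrap (counts-⊎ c c′
      (λ B B′ → proj₂ (upper B′ (lower B (inj₂ refl))) refl)
      (λ {M} → mk⇔
        (λ (between S l h) → split M S l h)
        [ (λ (between S l h) → between S (l ∘ inj₁) h) , (λ (between S l h) → between S l (proj₁ ∘ h)) ]′))
      where
      split : ∀ M → Diagram G M → L ⊆ Support M → Support M ⊆ H →
        BetweenM G (L ∪ (_≡ s)) H M ⊎ BetweenM G L (H ∩ (_≢ s)) M
      split M S l h with Support? M s
      ... | yes ∋s = inj₁ (between S [ l , (λ { refl → ∋s }) ]′ h)
      ... | no ∌s = inj₂ (between S l λ x∈ → h x∈ , λ { refl → ∌s x∈ })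

  -- A matrix built by `relation` agrees with the intended relation only up to logical equivalence.
  -- The identity embedding carries all the conditions across at once.
  between-cong : ∀ {L H} {R R′ : Rel (Fin (pow2 n)) 0ℓ} → (∀ {i j} → R i j ⇔ R′ i j) →
    Between G L H R → Between G L H R′
  between-cong {R = R} {R′} R⇔R′ (between S l h) =
    between (E.pushforward S) (to E.supp⇔ ∘ l) (h ∘ from E.supp⇔)
    where
    identity : Embedding (Adj G) (Mem {n}) R (Adj G) (Mem {n}) R′
    identity = record
      { e = id ; φ = id ; e-injective = id ; φ-injective = id
      ; G⇔ = mk⇔ id id ; R⇔ = R⇔R′ ; mem⇔ = mk⇔ id id
      ; mem-image = λ {_} {y} _ → y , refl
      ; R-image = λ {a} {b} _ → (a , refl) , (b , refl)
      }
    module E = Embedding identity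

Mem? : ∀ {n} (i : Fin (pow2 n)) → Decidable (Mem {n} i)
Mem? {n} i x = lookup (lookup (subsets n) i) x ≟ᵇ true

-- Diagrams supported on an induced subgraph.

module _ {m n : ℕ} {G₁ : Graph m} {G₂ : Graph n} (e : Fin m → Fin n)
  (e-injective : ∀ {x y} → e x ≡ e y → x ≡ y) (induced : ∀ x y → G₁ x y ≡ G₂ (e x) (e y)) where

  private
    image? : ∀ i → Decidable (λ y → ∃ λ x → e x ≡ y × Mem {m} i x)
    image? i y = any? λ x → (e x ≟ y) ×-dec Mem? {m} i x

    φ : Fin (pow2 m) → Fin (pow2 n)
    φ i = subset (image? i)

    Mem-φ : ∀ {i y} → Mem (φ i) y ⇔ ∃ λ x → e x ≡ y × Mem {m} i x
    Mem-φ {i} = Mem-subset (image? i)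

    mem⇔ : ∀ {i x} → Mem {m} i x ⇔ Mem (φ i) (e x)
    mem⇔ {i} {x} = mk⇔ (λ m → from Mem-φ (x , refl , m)) pull
      where
      pull : Mem (φ i) (e x) → Mem i x
      pull m with x′ , ex′≡ex , m′ ← to Mem-φ m = subst (Mem i) (e-injective ex′≡ex) m′

    φ-injective : ∀ {i j} → φ i ≡ φ j → i ≡ j
    φ-injective {i} {j} φi≡φj = Mem-ext {m} {i} {j} (mk⇔ (pull φi≡φj) (pull (sym φi≡φj)))
      where
      pull : ∀ {i j} → φ i ≡ φ j → Mem {m} i ⊆ Mem j
      pull {i} {j} φi≡φj {x} m = from mem⇔ (subst (λ a → Mem a (e x)) φi≡φj (to (mem⇔ {i}) m))

    φ-surjective : ∀ {a} → (∀ {y} → Mem {n} a y → ∃ λ x → e x ≡ y) → ∃ λ i → φ i ≡ a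
    φ-surjective {a} im = subset (λ x → Mem? {n} a (e x)) , Mem-ext {n} (mk⇔ fwd bwd)
      where
      fwd : Mem {n} (φ (subset (λ x → Mem? {n} a (e x)))) ⊆ Mem a
      fwd m with x , refl , m′ ← to Mem-φ m = to (Mem-subset (λ x → Mem? {n} a (e x))) m′
      bwd : Mem {n} a ⊆ Mem (φ (subset (λ x → Mem? {n} a (e x))))
      bwd m with x , refl ← im m = from Mem-φ (x , refl , from (Mem-subset (λ x → Mem? {n} a (e x))) m)

    embedding : {R₁ : Rel (Fin (pow2 m)) 0ℓ} {R₂ : Rel (Fin (pow2 n)) 0ℓ} →
      (∀ {i j} → R₁ i j ⇔ R₂ (φ i) (φ j)) →
      (∀ {a b} → R₂ a b → (∃ λ i → φ i ≡ a) × (∃ λ j → φ j ≡ b)) →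
      Embedding (Adj G₁) (Mem {m}) R₁ (Adj G₂) (Mem {n}) R₂
    embedding R⇔ R-image = record
      { e = e ; φ = φ ; e-injective = e-injective ; φ-injective = φ-injective
      ; G⇔ = λ {x} {y} → mk⇔ (trans (sym (induced x y))) (trans (induced x y))
      ; R⇔ = R⇔ ; mem⇔ = mem⇔
      ; mem-image = λ m → let x , ex≡y , _ = to Mem-φ m in x , ex≡y
      ; R-image = R-image
      }

    ImageRel : Rel (Fin (pow2 m)) 0ℓ → Rel (Fin (pow2 n)) 0ℓ
    ImageRel R a b = ∃ λ i → ∃ λ j → φ i ≡ a × φ j ≡ b × R i j

    imageRel? : ∀ M → Decidable₂ (ImageRel ⟦ M ⟧)
    imageRel? M a b = any? λ i → any? λ j → (φ i ≟ a) ×-dec (φ j ≟ b) ×-dec ⟦ M ⟧? i j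

    push : RelM m → RelM n
    push M = relation (imageRel? M)

    pull : RelM n → RelM m
    pull M = relation (λ i j → ⟦ M ⟧? (φ i) (φ j))

    ⟦push⟧ : ∀ M {a b} → ⟦ push M ⟧ a b ⇔ ImageRel ⟦ M ⟧ a b
    ⟦push⟧ M = ⟦relation⟧ (imageRel? M)

    ⟦pull⟧ : ∀ M {i j} → ⟦ pull M ⟧ i j ⇔ ⟦ M ⟧ (φ i) (φ j)
    ⟦pull⟧ M = ⟦relation⟧ (λ i j → ⟦ M ⟧? (φ i) (φ j))

    ⟦push⟧-φ : ∀ M {i j} → ⟦ M ⟧ i j ⇔ ⟦ push M ⟧ (φ i) (φ j)
    ⟦push⟧-φ M {i} {j} = mk⇔ (λ r → from (⟦push⟧ M) (i , j , refl , refl , r)) (back ∘ to (⟦push⟧ M))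
      where
      back : ImageRel ⟦ M ⟧ (φ i) (φ j) → ⟦ M ⟧ i j
      back (i′ , j′ , φi′≡ , φj′≡ , r) with refl ← φ-injective φi′≡ | refl ← φ-injective φj′≡ = r

    push-embedding : ∀ M → Embedding (Adj G₁) (Mem {m}) ⟦ M ⟧ (Adj G₂) (Mem {n}) ⟦ push M ⟧
    push-embedding M = embedding (⟦push⟧-φ M)
      (λ r → let i , j , φi≡ , φj≡ , _ = to (⟦push⟧ M) r in (i , φi≡) , (j , φj≡))

  module _ {L₁ : Pred (Fin m) 0ℓ} {L₂ H : Pred (Fin n) 0ℓ} (H⇔ : ∀ {s} → H s ⇔ ∃ λ x → e x ≡ s)
    (L⇔ : ∀ {x} → L₁ x ⇔ L₂ (e x)) (L₂⊆H : L₂ ⊆ H) where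

    private
      R-image : ∀ {M} → BetweenM G₂ L₂ H M → ∀ {a b} → ⟦ M ⟧ a b → (∃ λ i → φ i ≡ a) × (∃ λ j → φ j ≡ b)
      R-image B r = let b , b′ = Staircase.blocks (staircase B) r in
        φ-surjective (λ m → to H⇔ (upper B (_ , b , m))) , φ-surjective (λ m → to H⇔ (upper B (_ , b′ , m)))

      push-between : ∀ {M} → BetweenM G₁ L₁ U M → BetweenM G₂ L₂ H (push M)
      push-between {M} (between S l _) = between (E.pushforward S) lower′ (from H⇔ ∘ E.supp-image)
        where
        module E = Embedding (push-embedding M)
        lower′ : L₂ ⊆ Support (push M)
        lower′ l₂ with x , refl ← to H⇔ (L₂⊆H l₂) = to E.supp⇔ (l (from L⇔ l₂))

      pull-between : ∀ {M} → BetweenM G₂ L₂ H M → BetweenM G₁ L₁ U (pull M)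
      pull-between {M} B = between (E.pullback (staircase B))
        (λ l → from E.supp⇔ (lower B (to L⇔ l))) (λ _ → _)
        where module E = Embedding (embedding (⟦pull⟧ M) (R-image {M} B))

      pull-push : ∀ M → M ≡ pull (push M)
      pull-push M = ⟦⟧-ext (mk⇔ (from (⟦pull⟧ (push M)) ∘ to (⟦push⟧-φ M))
                                (from (⟦push⟧-φ M) ∘ to (⟦pull⟧ (push M))))

      push-pull : ∀ {M} → BetweenM G₂ L₂ H M → M ≡ push (pull M)
      push-pull {M} B = ⟦⟧-ext (mk⇔ fwd bwd)
        where
        fwd : ∀ {a b} → ⟦ M ⟧ a b → ⟦ push (pull M) ⟧ a b
        fwd r with (i , refl) , (j , refl) ← R-image {M} B r =
          from (⟦push⟧ (pull M)) (i , j , refl , refl , from (⟦pull⟧ M) r)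
        bwd : ∀ {a b} → ⟦ push (pull M) ⟧ a b → ⟦ M ⟧ a b
        bwd r with i , j , refl , refl , r′ ← to (⟦push⟧ (pull M)) r = to (⟦pull⟧ M) r′

    -- The blocks of a diagram supported in the image of `e` are images of subsets, so `pull`
    -- forgets nothing of it. Conversely `push` leaves all other subsets unrelated, which keeps them
    -- from being blocks.
    counts-induced : ∀ {k} → CountsBetween G₁ L₁ U k → CountsBetween G₂ L₂ H k
    counts-induced (wrap c) = wrap (counts-bijection push pull
      (λ {M} → push-between {M}) (λ {M} → pull-between {M}) (λ {M} _ → pull-push M) (λ {M} → push-pull {M}) c)

-- Products of counts over separated vertex sets.

module _ {n : ℕ} {G : Graph n} {L L′ H W : Pred (Fin n) 0ℓ} (H? : Decidable H) (W? : Decidable W)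
  (separated : Separated (Adj G) H W) where

  private
    restrict? : ∀ {K} → Decidable K → (M : RelM n) → Decidable₂ (Restrict (Mem {n}) K ⟦ M ⟧)
    restrict? {K} K? M i j = ⟦ M ⟧? i j ×-dec within? i ×-dec within? j
      where
      within? : ∀ i → Dec (Mem {n} i ⊆ K)
      within? i = map′ (λ f {x} → f x) (λ f x → f {x}) (all? λ x → Mem? {n} i x →-dec K? x)

    ⟦restrict⟧ : ∀ {K} (K? : Decidable K) M {i j} →
      ⟦ relation (restrict? K? M) ⟧ i j ⇔ Restrict (Mem {n}) K ⟦ M ⟧ i j
    ⟦restrict⟧ K? M = ⟦relation⟧ (restrict? K? M)

    join : RelM n × RelM n → RelM n
    join (M₁ , M₂) = relation (λ i j → ⟦ M₁ ⟧? i j ⊎-dec ⟦ M₂ ⟧? i j)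

    ⟦join⟧ : ∀ M₁ M₂ {i j} → ⟦ join (M₁ , M₂) ⟧ i j ⇔ (⟦ M₁ ⟧ i j ⊎ ⟦ M₂ ⟧ i j)
    ⟦join⟧ M₁ M₂ = ⟦relation⟧ (λ i j → ⟦ M₁ ⟧? i j ⊎-dec ⟦ M₂ ⟧? i j)

    parts : RelM n → RelM n × RelM n
    parts M = relation (restrict? H? M) , relation (restrict? W? M)

    Pairs : Pred (RelM n × RelM n) 0ℓ
    Pairs (M₁ , M₂) = BetweenM G L H M₁ × BetweenM G L′ W M₂

    join-between : ∀ {Ms} → Pairs Ms → BetweenM G (L ∪ L′) (H ∪ W) (join Ms)
    join-between {M₁ , M₂} (between S₁ l₁ h₁ , between S₂ l₂ h₂) =
      between-cong (mk⇔ (from (⟦join⟧ M₁ M₂)) (to (⟦join⟧ M₁ M₂)))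
        (between (union-staircase separated S₁ S₂ h₁ h₂)
          (λ where
            (inj₁ l) → let i , b , m = l₁ l in i , inj₁ b , m
            (inj₂ l) → let i , b , m = l₂ l in i , inj₂ b , m)
          (λ where
            (i , inj₁ b , m) → inj₁ (h₁ (i , b , m))
            (i , inj₂ b , m) → inj₂ (h₂ (i , b , m))))

    -- The block through a vertex of `L` meets `K`, so it lies wholly in `K` and survives the
    -- restriction; this preserves the lower bound.
    restrict-between : ∀ {K K′ L} (M : RelM n) → Separated (Adj G) K K′ → Diagram G M →
      Support M ⊆ K ∪ K′ → L ⊆ K → L ⊆ Support M → Between G L K (Restrict (Mem {n}) K ⟦ M ⟧)
    restrict-between {K} {L = L} M sep S supp L⊆K l = between (restrict-staircase ⟦ M ⟧? sep S supp) lower′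
      (λ (_ , (_ , ⊆K , _) , m) → ⊆K m)
      where
      lower′ : L ⊆ Supp (Mem {n}) (Restrict (Mem {n}) K ⟦ M ⟧)
      lower′ x∈L = let i , b , m = l x∈L
                       ⊆K : Mem {n} i ⊆ K
                       ⊆K = block-within ⟦ M ⟧? sep S supp b m (L⊆K x∈L)
                   in i , (b , ⊆K , ⊆K) , m

    join-parts : ∀ {M} → BetweenM G (L ∪ L′) (H ∪ W) M → M ≡ join (parts M)
    join-parts {M} (between S _ h) = ⟦⟧-ext (mk⇔
      (λ r → from (uncurry ⟦join⟧ (parts M)) (Sum.map (from (⟦restrict⟧ H? M))
        (from (⟦restrict⟧ W? M)) (to cover r)))
      (λ r → from cover (Sum.map (to (⟦restrict⟧ H? M)) (to (⟦restrict⟧ W? M))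
        (to (uncurry ⟦join⟧ (parts M)) r))))
      where
      cover : ∀ {i j} → ⟦ M ⟧ i j ⇔ (Restrict (Mem {n}) H ⟦ M ⟧ i j ⊎ Restrict (Mem {n}) W ⟦ M ⟧ i j)
      cover = restrict-cover ⟦ M ⟧? separated S h

    restrict-join : ∀ {K} M₁ M₂ i j →
      Restrict (Mem {n}) K (λ i j → ⟦ M₁ ⟧ i j ⊎ ⟦ M₂ ⟧ i j) i j ⇔ Restrict (Mem {n}) K ⟦ join (M₁ , M₂) ⟧ i j
    restrict-join M₁ M₂ i j = mk⇔ (Product.map₁ (from (⟦join⟧ M₁ M₂))) (Product.map₁ (to (⟦join⟧ M₁ M₂)))

    parts-join : ∀ {Ms} → Pairs Ms → Ms ≡ parts (join Ms)
    parts-join {M₁ , M₂} (between S₁ _ h₁ , between S₂ _ h₂) = cong₂ _,_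
      (part H? (restrict-union₁ separated S₁ S₂ h₁ h₂)) (part W? (restrict-union₂ separated S₁ S₂ h₁ h₂))
      where
      part : ∀ {K} (K? : Decidable K) {M : RelM n} →
        (∀ {i j} → ⟦ M ⟧ i j ⇔ Restrict (Mem {n}) K (λ i j → ⟦ M₁ ⟧ i j ⊎ ⟦ M₂ ⟧ i j) i j) →
        M ≡ relation (restrict? K? (join (M₁ , M₂)))
      part K? eq = ⟦⟧-ext λ {i} {j} → mk⇔
        (from (⟦restrict⟧ K? (join (M₁ , M₂))) ∘ to (restrict-join M₁ M₂ i j) ∘ to eq)
        (from eq ∘ from (restrict-join M₁ M₂ i j) ∘ to (⟦restrict⟧ K? (join (M₁ , M₂))))

  counts-separated : L ⊆ H → L′ ⊆ W → ∀ {p q} → CountsBetween G L H p → CountsBetween G L′ W q →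
    CountsBetween G (L ∪ L′) (H ∪ W) (p * q)
  counts-separated L⊆H L′⊆W (wrap c) (wrap c′) = wrap (counts-bijection join parts (λ {Ms} → join-between {Ms})
    (λ {M} (between S l h) →
      between-cong (mk⇔ (from (⟦restrict⟧ H? M)) (to (⟦restrict⟧ H? M)))
        (restrict-between M separated S h L⊆H (l ∘ inj₁)) ,
      between-cong (mk⇔ (from (⟦restrict⟧ W? M)) (to (⟦restrict⟧ W? M)))
        (restrict-between M (separated-sym separated) S (Sum.swap ∘ h) L′⊆W (l ∘ inj₂)))
    (λ {Ms} → parts-join {Ms}) join-parts (counts-× c c′))

-- The graph D_n

pathAdj : ℕ → ℕ → Bool
pathAdj x y = (suc x ≡ᵇ y) ∨ (suc y ≡ᵇ x)

dAdj : ℕ → ℕ → Bool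
dAdj x y = dEdge x y ∨ dEdge y x

private
  ≡ᵇ-sym : ∀ x y → (x ≡ᵇ y) ≡ (y ≡ᵇ x)
  ≡ᵇ-sym zero zero = refl
  ≡ᵇ-sym zero (suc y) = refl
  ≡ᵇ-sym (suc x) zero = refl
  ≡ᵇ-sym (suc x) (suc y) = ≡ᵇ-sym x y

  edge-shift : ∀ c x y → (suc x ≡ᵇ y) ≡ dEdge (suc c + x) (suc c + y)
  edge-shift zero x y = trans (≡ᵇ-sym (suc x) y) (sym (∨-identityʳ (y ≡ᵇ suc x)))
  edge-shift (suc c) x y = edge-shift c x y

  -- From index 1 on, `D_n` is a path; shifting by at least one avoids the exceptional vertex 0.
  adj-shift : ∀ c x y → pathAdj x y ≡ dAdj (suc c + x) (suc c + y)
  adj-shift c x y = cong₂ _∨_ (edge-shift c x y) (edge-shift c y x)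

  -- Enumerates the path 0, 2, 3, ... that is left of `D_n` when `s_2`, of index 1, is dropped.
  skip-one : ℕ → ℕ
  skip-one zero = zero
  skip-one (suc x) = suc (suc x)

  skip-one-injective : ∀ {x y} → skip-one x ≡ skip-one y → x ≡ y
  skip-one-injective {zero} {zero} _ = refl
  skip-one-injective {suc x} {suc y} eq = suc-injective eq

  adj-skip-one : ∀ x y → pathAdj x y ≡ dAdj (skip-one x) (skip-one y)
  adj-skip-one zero zero = refl
  adj-skip-one zero (suc y) = cong (_∨ false) (≡ᵇ-sym zero y)
  adj-skip-one (suc x) zero = ≡ᵇ-sym zero x
  adj-skip-one (suc x) (suc y) = adj-shift 1 x y

  dEdge⇒ : ∀ {x y} → dEdge x y ≡ true → y ≡ suc x ⊎ (x ≡ 0 × y ≡ 2)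
  dEdge⇒ {x} {y} = Sum.map₁ proj₂ ∘ to (reflects-true
    ((≤ᵇ-reflects-≤ 1 x ×-reflects proof (y ℕ.≟ suc x)) ⊎-reflects (proof (x ℕ.≟ 0) ×-reflects proof (y ℕ.≟ 2))))

  dAdj⇒ : ∀ {x y} → dAdj x y ≡ true → dEdge x y ≡ true ⊎ dEdge y x ≡ true
  dAdj⇒ {x} {y} = to (reflects-true (≡true-reflects (dEdge x y) ⊎-reflects ≡true-reflects (dEdge y x)))

module _ {m n : ℕ} {g₁ g₂ : ℕ → ℕ → Bool} (f : ℕ → ℕ) (f-injective : ∀ {x y} → f x ≡ f y → x ≡ y)
  (induced : ∀ x y → g₁ x y ≡ g₂ (f x) (f y)) (bound : ∀ {x} → x < m → f x < n)
  (H : Pred ℕ 0ℓ) (into : ∀ {x} → x < m → H (f x))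
  (onto : ∀ {s} → s < n → H s → ∃ λ x → x < m × f x ≡ s) where

  private
    G₁ : Graph m
    G₁ i j = g₁ (toℕ i) (toℕ j)

    G₂ : Graph n
    G₂ i j = g₂ (toℕ i) (toℕ j)

    e : Fin m → Fin n
    e x = fromℕ< (bound (toℕ<n x))

    toℕ-e : ∀ x → toℕ (e x) ≡ f (toℕ x)
    toℕ-e x = toℕ-fromℕ< (bound (toℕ<n x))

    e-injective : ∀ {x y} → e x ≡ e y → x ≡ y
    e-injective {x} {y} eq = toℕ-injective (f-injective
      (trans (sym (toℕ-e x)) (trans (cong toℕ eq) (toℕ-e y))))

    e-induced : ∀ x y → G₁ x y ≡ G₂ (e x) (e y)
    e-induced x y = trans (induced (toℕ x) (toℕ y)) (sym (cong₂ g₂ (toℕ-e x) (toℕ-e y)))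

    H-e : ∀ x → H (toℕ (e x))
    H-e x = subst H (sym (toℕ-e x)) (into (toℕ<n x))

    H⇔ : ∀ {s} → H (toℕ s) ⇔ ∃ λ x → e x ≡ s
    H⇔ {s} = mk⇔ preimage (λ (x , ex≡s) → subst (H ∘ toℕ) ex≡s (H-e x))
      where
      preimage : H (toℕ s) → ∃ λ x → e x ≡ s
      preimage h with x , x<m , fx≡s ← onto (toℕ<n s) h = fromℕ< x<m , toℕ-injective
        (trans (toℕ-e (fromℕ< x<m)) (trans (cong f (toℕ-fromℕ< x<m)) fx≡s))

  counts-induced-all : CountsBetween G₂ ∅ (H ∘ toℕ) (numStaircase G₁)
  counts-induced-all = counts-induced e e-injective e-induced H⇔ (mk⇔ id id) (λ ()) (counts-all G₁)

  counts-induced-full : CountsBetween G₂ (H ∘ toℕ) (H ∘ toℕ) (numStaircaseFull G₁)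
  counts-induced-full = counts-induced e e-injective e-induced H⇔
    (λ {x} → mk⇔ (λ _ → H-e x) (λ _ → _)) id (counts-full G₁)

Below Above Is : {n : ℕ} → ℕ → Pred (Fin n) 0ℓ
Below k s = toℕ s < k
Above k s = k < toℕ s
Is k s = toℕ s ≡ k

-- The `r` vertices behind index `c` form a path, also for `c = 0`, where just `s_1` is dropped.
counts-above : ∀ c r {n} → n ≡ suc c + r → CountsBetween (DGraph n) ∅ (Above c) (a r)
counts-above c r refl = counts-induced-all {g₁ = pathAdj} {g₂ = dAdj} (_+_ (suc c)) (λ {x} {y} → +-cancelˡ-≡ (suc c) x y)
  (adj-shift c) (+-monoʳ-< (suc c)) (c <_) (λ {x} _ → s≤s (m≤m+n c x))
  λ {s} s<n c<s → s ∸ suc c , +-cancelˡ-< (suc c) (s ∸ suc c) r (subst (_< suc c + r) (sym (m+[n∸m]≡n c<s)) s<n) ,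
    m+[n∸m]≡n c<s

counts-avoiding-one : ∀ r → CountsBetween (DGraph (suc (suc r))) ∅ (λ s → toℕ s ≢ 1) (a (suc r))
counts-avoiding-one r = counts-induced-all {g₁ = pathAdj} {g₂ = dAdj} skip-one skip-one-injective
  adj-skip-one (λ { {zero} _ → z<s ; {suc x} x<m → s<s x<m }) (_≢ 1) (λ { {zero} _ () ; {suc x} _ () })
  λ { {zero} _ _ → 0 , z<s , refl
    ; {suc zero} _ 1≢1 → contradiction refl 1≢1
    ; {suc (suc s)} s<n _ → suc s , s<s⁻¹ s<n , refl }

counts-below : ∀ k {n} → k ≤ n → CountsBetween (DGraph n) (Below k) (Below k) (dbar k)
counts-below k k≤n = counts-induced-full {g₁ = dAdj} {g₂ = dAdj} id id (λ _ _ → refl) (λ x<k → <-≤-trans x<k k≤n)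
  (_< k) id (λ {s} _ s<k → s , s<k , refl)

-- The `1` is the number of fully supported diagrams on a single vertex, obtained by evaluating the
-- enumeration of the 16 relations on two subsets.
counts-zero : ∀ n → CountsBetween (DGraph (suc n)) (Is 0) (Is 0) 1
counts-zero n = counts-induced-full {m = 1} {g₁ = pathAdj} {g₂ = dAdj} skip-one skip-one-injective
  adj-skip-one (λ { {zero} _ → z<s ; {suc x} (s≤s ()) }) (_≡ 0) (λ { {zero} _ → refl ; {suc x} (s≤s ()) })
  λ { _ refl → 0 , z<s , refl }

counts-one : ∀ n → CountsBetween (DGraph (suc (suc n))) (Is 1) (Is 1) 1
counts-one n = counts-induced-full {m = 1} {g₁ = pathAdj} {g₂ = dAdj} suc suc-injective
  (adj-shift 0) (λ { {zero} _ → s<s z<s ; {suc x} (s≤s ()) }) (_≡ 1) (λ { {zero} _ → refl ; {suc x} (s≤s ()) })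
  λ { _ refl → 0 , z<s , refl }

-- For `k = 1` the edge between indices 0 and 2 would join the two sides; from `2 ≤ k` on, no edge
-- passes over index `k`.
below-above-separated : ∀ {n} k → 2 ≤ k → Separated (Adj (DGraph n)) (Below k) (Above k)
below-above-separated {n} k 2≤k = record
  { disjoint = <-asym
  ; no-edge = λ {s} {t} s<k k<t g → no-edge s<k k<t (dAdj⇒ {toℕ s} {toℕ t} g)
  ; no-edge′ = λ {s} {t} s<k k<t g → no-edge s<k k<t (Sum.swap (dAdj⇒ {toℕ t} {toℕ s} g))
  }
  where
  no-edge : ∀ {s t} → s < k → k < t → ¬ (dEdge s t ≡ true ⊎ dEdge t s ≡ true)
  no-edge {s} {t} s<k k<t (inj₁ st) with dEdge⇒ {s} {t} st
  ... | inj₁ refl = <-irrefl refl (≤-<-trans s<k k<t)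
  ... | inj₂ (_ , refl) = <-irrefl refl (<-≤-trans k<t 2≤k)
  no-edge {s} {t} s<k k<t (inj₂ ts) with dEdge⇒ {t} {s} ts
  ... | inj₁ refl = <-asym (<-trans s<k k<t) (n<1+n _)
  ... | inj₂ (refl , _) with () ← k<t

zero-one-separated : ∀ {n} → Separated (Adj (DGraph n)) (Is 0) (Is 1)
zero-one-separated = record
  { disjoint = λ s≡0 s≡1 → contradiction (trans (sym s≡0) s≡1) λ ()
  ; no-edge = λ s≡0 t≡1 g → contradiction (trans (sym (cong₂ dAdj s≡0 t≡1)) g) λ ()
  ; no-edge′ = λ s≡0 t≡1 g → contradiction (trans (sym (cong₂ dAdj t≡1 s≡0)) g) λ ()
  }

counts-d : ∀ n → CountsBetween (DGraph n) ∅ U (d n)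
counts-d n = counts-all (DGraph n)

-- The recurrence for the number of diagrams on `D_n`.

module _ (m : ℕ) where

  private
    N : ℕ
    N = 3 + m

    G : Graph N
    G = DGraph N

    first second third : Fin N
    first = zero
    second = suc zero
    third = suc (suc zero)

  -- The number of diagrams whose support contains the first N ∸ r vertices, summed over the
  -- first missing vertex: when that is vertex i (from 0), dbar i * a (N ∸ suc i) diagrams occur.
  spanning-below : ℕ → ℕ
  spanning-below zero = dbar N
  spanning-below (suc r) = spanning-below r + dbar (2 + m ∸ r) * a r

  -- Induction on the number `r` of vertices behind the first `3 + k`, deciding about the vertex `v`
  -- of index `3 + k`. If it is missing, the support is full before it and free behind it; if it
  -- occurs, `k` grows by one.
  counts-containing-below : ∀ k r → m ≡ k + r → CountsBetween G (Below (3 + k)) U (spanning-below r)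
  counts-containing-below k zero m≡k+0 = counts-≐
    ((λ {x} _ → everywhere (cong (_+_ 3) (trans m≡k+0 (+-identityʳ k))) x) , λ {x} _ → everywhere refl x)
    ((λ _ → _) , λ {x} _ → everywhere refl x) (counts-below N ≤-refl)
    where
    everywhere : ∀ {d} → N ≡ d → ∀ (x : Fin N) → toℕ x < d
    everywhere refl = toℕ<n
  counts-containing-below k (suc r) m≡ = counts-partition v
    (counts-≐ (below-suc , below-suc⁻¹) (id , id)
      (counts-containing-below (suc k) r (trans m≡ (+-suc k r))))
    -- `spanning-below` has only `r` at hand, so the index `3 + k` of the missing vertex appears in
    -- it as `2 + m ∸ r`.
    (subst (λ d → CountsBetween G (Below (3 + k)) (U ∩ (_≢ v)) (dbar d * a r)) 3+k≡
      (counts-≐ ([ id , (λ ()) ]′ , inj₁) (below-above , below-above⁻¹)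
        (counts-separated (λ s → toℕ s <? 3 + k) (λ s → 3 + k <? toℕ s) (below-above-separated (3 + k) (s≤s (s≤s z≤n)))
          id (λ ()) (counts-below (3 + k) (<⇒≤ v<N)) (counts-above (3 + k) r N≡))))
    where
    N≡ : N ≡ suc (3 + k) + r
    N≡ = cong (_+_ 3) (trans m≡ (+-suc k r))
    3+k≡ : 3 + k ≡ 2 + m ∸ r
    3+k≡ = sym (trans (cong (_∸ r) (suc-injective N≡)) (m+n∸n≡m (3 + k) r))
    v<N : 3 + k < N
    v<N = subst (3 + k <_) (sym N≡) (s≤s (m≤m+n (3 + k) r))
    v : Fin N
    v = fromℕ< v<N
    toℕ-v : toℕ v ≡ 3 + k
    toℕ-v = toℕ-fromℕ< v<N
    below-suc : Below (4 + k) ⊆ Below (3 + k) ∪ (_≡ v)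
    below-suc (s≤s x≤) = Sum.map id (λ x≡ → toℕ-injective (trans x≡ (sym toℕ-v))) (m≤n⇒m<n∨m≡n x≤)
    below-suc⁻¹ : Below (3 + k) ∪ (_≡ v) ⊆ Below (4 + k)
    below-suc⁻¹ (inj₁ x<) = m≤n⇒m≤1+n x<
    below-suc⁻¹ (inj₂ refl) = s≤s (≤-reflexive toℕ-v)
    below-above : Below (3 + k) ∪ Above (3 + k) ⊆ U ∩ (_≢ v)
    below-above (inj₁ x<) = _ , λ { refl → <⇒≢ x< toℕ-v }
    below-above (inj₂ x>) = _ , λ { refl → >⇒≢ x> toℕ-v }
    below-above⁻¹ : U ∩ (_≢ v) ⊆ Below (3 + k) ∪ Above (3 + k)
    below-above⁻¹ {x} (_ , x≢v) with <-cmp (toℕ x) (3 + k)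
    ... | tri< x< _ _ = inj₁ x<
    ... | tri≈ _ x≡ _ = contradiction (toℕ-injective (trans x≡ (sym toℕ-v))) x≢v
    ... | tri> _ _ x> = inj₂ x>

  -- `s_3` is the only neighbour of `s_1` and of `s_2`. Without it these two are isolated and
  -- contribute a factor `1` each, beside the path on the last `m` vertices.
  counts-containing-first-two : CountsBetween G (Is 0 ∪ Is 1) U (spanning-below m + a m)
  counts-containing-first-two = counts-partition third
    (counts-≐ (below-three , below-three⁻¹) (id , id) (counts-containing-below 0 m refl))
    (subst (CountsBetween G (Is 0 ∪ Is 1) (U ∩ (_≢ third))) (*-identityˡ (a m))
      (counts-≐ ([ id , (λ ()) ]′ , inj₁) (not-third , not-third⁻¹)
        (counts-separated (λ s → toℕ s <? 2) (λ s → 2 <? toℕ s) (below-above-separated 2 ≤-refl)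
          below-two (λ ())
          (counts-≐ (id , id) (below-two , below-two⁻¹)
            (counts-separated (λ s → toℕ s ℕ.≟ 0) (λ s → toℕ s ℕ.≟ 1) zero-one-separated id id
              (counts-zero (2 + m)) (counts-one (1 + m))))
          (counts-above 2 m refl))))
    where
    below-three : Below 3 ⊆ (Is 0 ∪ Is 1) ∪ (_≡ third)
    below-three {zero} _ = inj₁ (inj₁ refl)
    below-three {suc zero} _ = inj₁ (inj₂ refl)
    below-three {suc (suc zero)} _ = inj₂ refl
    below-three {suc (suc (suc x))} (s≤s (s≤s (s≤s ())))
    below-three⁻¹ : (Is 0 ∪ Is 1) ∪ (_≡ third) ⊆ Below {N} 3
    below-three⁻¹ {zero} _ = z<s
    below-three⁻¹ {suc zero} _ = s<s z<s
    below-three⁻¹ {suc (suc zero)} _ = ≤-refl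
    below-three⁻¹ {suc (suc (suc x))} (inj₁ (inj₁ ()))
    below-three⁻¹ {suc (suc (suc x))} (inj₁ (inj₂ ()))
    below-two : Is 0 ∪ Is 1 ⊆ Below {N} 2
    below-two (inj₁ x≡0) = subst (_< 2) (sym x≡0) z<s
    below-two (inj₂ x≡1) = subst (_< 2) (sym x≡1) ≤-refl
    below-two⁻¹ : Below {N} 2 ⊆ Is 0 ∪ Is 1
    below-two⁻¹ {zero} _ = inj₁ refl
    below-two⁻¹ {suc zero} _ = inj₂ refl
    below-two⁻¹ {suc (suc x)} (s≤s (s≤s ()))
    not-third : Below 2 ∪ Above 2 ⊆ U ∩ (_≢ third)
    not-third (inj₁ x<2) = _ , λ { refl → <-irrefl refl x<2 }
    not-third (inj₂ x>2) = _ , λ { refl → <-irrefl refl x>2 }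
    not-third⁻¹ : U ∩ (_≢ third) ⊆ Below 2 ∪ Above 2
    not-third⁻¹ {zero} _ = inj₁ z<s
    not-third⁻¹ {suc zero} _ = inj₁ ≤-refl
    not-third⁻¹ {suc (suc zero)} (_ , third≢) = contradiction refl third≢
    not-third⁻¹ {suc (suc (suc x))} _ = inj₂ (s<s (s<s z<s))

  -- With `x` the number of diagrams that contain `s_1` and avoid `s_2`, inclusion-exclusion splits
  -- into an equation for `d N` and one for `a (2 + m)`. Eliminating `x` between them avoids
  -- subtraction in the natural numbers.
  d-recurrence : d N + a (1 + m) ≡ spanning-below m + a m + a (2 + m) + a (2 + m)
  d-recurrence = begin
    d N + a (1 + m)                                          ≡⟨ cong (_+ a (1 + m)) d≡ ⟩
    spanning-below m + a m + x + a (2 + m) + a (1 + m)       ≡⟨ swap (spanning-below m + a m) x (a (2 + m)) (a (1 + m)) ⟩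
    spanning-below m + a m + a (2 + m) + (x + a (1 + m))     ≡⟨ cong (_+_ (spanning-below m + a m + a (2 + m))) (sym a≡) ⟩
    spanning-below m + a m + a (2 + m) + a (2 + m)           ∎
    where
    open ≡-Reasoning
    swap : ∀ p q r s → p + q + r + s ≡ p + r + (q + s)
    swap = solve-∀ℕ
    not-second : (λ s → toℕ s ≢ 1) ≐ (_≢ second)
    not-second = (λ { x≢1 refl → x≢1 refl }) , λ x≢second x≡1 → x≢second (toℕ-injective x≡1)
    avoiding-second : CountsBetween G ∅ (_≢ second) (a (2 + m))
    avoiding-second = counts-≐ (id , id) not-second (counts-avoiding-one (1 + m))
    first-only : ∃ (CountsBetween G (∅ ∪ (_≡ first)) (_≢ second))
    first-only = counts-containing first avoiding-second
    x : ℕ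
    x = proj₁ first-only
    -- The diagrams avoiding `s_2` are counted twice: as diagrams on a path, and according to
    -- whether `s_1` occurs.
    a≡ : a (2 + m) ≡ x + a (1 + m)
    a≡ = countsBetween-unique avoiding-second (counts-partition first (proj₂ first-only)
      (counts-≐ (id , id) (neither , neither⁻¹) (counts-above 1 (1 + m) refl)))
      where
      neither : Above 1 ⊆ (_≢ second) ∩ (_≢ first)
      neither x>1 = (λ { refl → <-irrefl refl x>1 }) , λ { refl → contradiction x>1 λ () }
      neither⁻¹ : (_≢ second) ∩ (_≢ first) ⊆ Above 1
      neither⁻¹ {zero} (_ , first≢) = contradiction refl first≢
      neither⁻¹ {suc zero} (second≢ , _) = contradiction refl second≢
      neither⁻¹ {suc (suc _)} _ = s<s z<s
    d≡ : d N ≡ spanning-below m + a m + x + a (2 + m)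
    d≡ = countsBetween-unique (counts-d N) (counts-partition first
      (counts-partition second
        (counts-≐ (first-two , first-two⁻¹) (id , id) counts-containing-first-two)
        (counts-≐ (id , id) ((λ x≢ → _ , x≢) , proj₂) (proj₂ first-only)))
      (counts-≐ (id , id) (not-first , not-first⁻¹) (counts-above 0 (2 + m) refl)))
      where
      first-two : Is 0 ∪ Is 1 ⊆ (∅ ∪ (_≡ first)) ∪ (_≡ second)
      first-two (inj₁ x≡0) = inj₁ (inj₂ (toℕ-injective x≡0))
      first-two (inj₂ x≡1) = inj₂ (toℕ-injective x≡1)
      first-two⁻¹ : (∅ ∪ (_≡ first)) ∪ (_≡ second) ⊆ Is 0 ∪ Is 1
      first-two⁻¹ (inj₁ (inj₂ refl)) = inj₁ refl
      first-two⁻¹ (inj₂ refl) = inj₂ refl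
      not-first : Above 0 ⊆ U ∩ (_≢ first)
      not-first x>0 = _ , λ { refl → <-irrefl refl x>0 }
      not-first⁻¹ : U ∩ (_≢ first) ⊆ Above 0
      not-first⁻¹ {zero} (_ , first≢) = contradiction refl first≢
      not-first⁻¹ {suc _} _ = z<s

-- Power series

∑< : ℕ → Series → ℤ
∑< n f = foldr ℤ._+_ (+ 0) (applyUpTo f n)

∑<-cong : ∀ n {f g} → (∀ {k} → k < n → f k ≡ g k) → ∑< n f ≡ ∑< n g
∑<-cong zero eq = refl
∑<-cong (suc n) eq = cong₂ ℤ._+_ (eq (s≤s z≤n)) (∑<-cong n (eq ∘ s≤s))

∑<-zero : ∀ n → ∑< n (λ _ → + 0) ≡ + 0
∑<-zero zero = refl
∑<-zero (suc n) = trans (ℤₚ.+-identityˡ _) (∑<-zero n)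

∑<-suc : ∀ n f → ∑< (suc n) f ≡ ∑< n f ℤ.+ f n
∑<-suc zero f = ℤₚ.+-comm (f 0) (+ 0)
∑<-suc (suc n) f = trans (cong (λ z → f 0 ℤ.+ z) (∑<-suc n (f ∘ suc))) (sym (ℤₚ.+-assoc (f 0) _ _))

⊗-∑< : ∀ f g n → (f ⊗ g) n ≡ ∑< (suc n) (λ k → f k ℤ.* g (n ∸ k))
⊗-∑< f g n = cong (foldr ℤ._+_ (+ 0)) (map-upTo (λ k → f k ℤ.* g (n ∸ k)) (suc n))

2t-t²+t³ : Series
2t-t²+t³ = poly (+ 0 ∷ + 2 ∷ - (+ 1) ∷ + 1 ∷ [])

1·t : Series
1·t = poly (+ 0 ∷ + 1 ∷ [])

module _ (A B : Series) where

  [2t-t²+t³]⊗A : ∀ m → (2t-t²+t³ ⊗ A) (3 + m) ≡ + 2 ℤ.* A (2 + m) ℤ.- A (1 + m) ℤ.+ A m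
  [2t-t²+t³]⊗A m = begin
    (2t-t²+t³ ⊗ A) (3 + m)
      ≡⟨ ⊗-∑< 2t-t²+t³ A (3 + m) ⟩
    -- Products with the vanishing coefficients of the polynomial evaluate to `+ 0`, which leaves a
    -- sum of `m` zeros behind the cubic term.
    + 0 ℤ.+ (+ 2 ℤ.* A (2 + m) ℤ.+ (- (+ 1) ℤ.* A (1 + m) ℤ.+ (+ 1 ℤ.* A m ℤ.+ ∑< m (λ _ → + 0))))
      ≡⟨ cong (λ z → + 0 ℤ.+ (+ 2 ℤ.* A (2 + m) ℤ.+ (- (+ 1) ℤ.* A (1 + m) ℤ.+ (+ 1 ℤ.* A m ℤ.+ z)))) (∑<-zero m) ⟩
    + 0 ℤ.+ (+ 2 ℤ.* A (2 + m) ℤ.+ (- (+ 1) ℤ.* A (1 + m) ℤ.+ (+ 1 ℤ.* A m ℤ.+ + 0)))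
      ≡⟨ collect (A (2 + m)) (A (1 + m)) (A m) ⟩
    + 2 ℤ.* A (2 + m) ℤ.- A (1 + m) ℤ.+ A m ∎
    where
    open ≡-Reasoning
    collect : ∀ x y z → + 0 ℤ.+ (+ 2 ℤ.* x ℤ.+ (- (+ 1) ℤ.* y ℤ.+ (+ 1 ℤ.* z ℤ.+ + 0))) ≡ + 2 ℤ.* x ℤ.- y ℤ.+ z
    collect = solve-∀

  tA+1 : Series
  tA+1 = 1·t ⊗ A ⊕ poly (+ 1 ∷ [])

  tA+1-suc : ∀ j → tA+1 (suc j) ≡ A j
  tA+1-suc j = begin
    (1·t ⊗ A) (suc j) ℤ.+ + 0                                    ≡⟨ ℤₚ.+-identityʳ _ ⟩
    (1·t ⊗ A) (suc j)                                            ≡⟨ ⊗-∑< 1·t A (suc j) ⟩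
    + 0 ℤ.+ (+ 1 ℤ.* A j ℤ.+ ∑< j (λ _ → + 0))                 ≡⟨ cong (λ z → + 0 ℤ.+ (+ 1 ℤ.* A j ℤ.+ z)) (∑<-zero j) ⟩
    + 0 ℤ.+ (+ 1 ℤ.* A j ℤ.+ + 0)                              ≡⟨ collect (A j) ⟩
    A j ∎
    where
    open ≡-Reasoning
    collect : ∀ x → + 0 ℤ.+ (+ 1 ℤ.* x ℤ.+ + 0) ≡ x
    collect = solve-∀

  -- The constant coefficient `1` gives the term `B n` for full support. The coefficient `A j` in
  -- degree `suc j` stands for a missing vertex followed by a path on `j` vertices.
  tA+1⊗B : ∀ n → (tA+1 ⊗ B) n ≡ B n ℤ.+ ∑< n (λ j → A j ℤ.* B (n ∸ suc j))
  tA+1⊗B n = trans (⊗-∑< tA+1 B n) (cong₂ ℤ._+_ (ℤₚ.*-identityˡ (B n))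
    (∑<-cong n (λ {j} _ → cong (ℤ._* B (n ∸ suc j)) (tA+1-suc j))))

  module _ (B0 : B 0 ≡ + 0) (B1 : B 1 ≡ + 0) (B2 : B 2 ≡ + 0) where

    -- The last three terms contain the factors `B 2`, `B 1` and `B 0`, which vanish.
    truncate : ∀ m → ∑< (3 + m) (λ j → A j ℤ.* B (2 + m ∸ j)) ≡ ∑< m (λ j → A j ℤ.* B (2 + m ∸ j))
    truncate m = trans (drop-last (2 + m) 0 refl B0)
      (trans (drop-last (1 + m) 1 refl B1) (drop-last m 2 refl B2))
      where
      drop-last : ∀ k r → r + k ≡ 2 + m → B r ≡ + 0 →
        ∑< (suc k) (λ j → A j ℤ.* B (2 + m ∸ j)) ≡ ∑< k (λ j → A j ℤ.* B (2 + m ∸ j))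
      drop-last k r r+k≡ Br≡0 = trans (∑<-suc k _) (trans (cong (λ z → ∑< k (λ j → A j ℤ.* B (2 + m ∸ j)) ℤ.+ z)
        (trans (cong (λ i → A k ℤ.* B i) (trans (cong (_∸ k) (sym r+k≡)) (m+n∸n≡m r k)))
          (trans (cong (A k ℤ.*_) Br≡0) (ℤₚ.*-zeroʳ (A k)))))
        (ℤₚ.+-identityʳ _))

    -- The recurrence covers the degrees from 3 on. Below that `D` and `B` vanish, and the
    -- polynomial cancels `2 A 0 = 2` in degree 1 and `2 A 1 - A 0 = 3` in degree 2.
    series-identity : (D : Series) → D 0 ≡ + 0 → D 1 ≡ + 0 → D 2 ≡ + 0 → A 0 ≡ + 1 → A 1 ≡ + 2 →
      (∀ m → D (3 + m) ≡ + 2 ℤ.* A (2 + m) ℤ.- A (1 + m) ℤ.+ A m ℤ.+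
                           (B (3 + m) ℤ.+ ∑< m (λ j → A j ℤ.* B (2 + m ∸ j)))) →
      ∀ n → D n ≡ (poly (+ 0 ∷ - (+ 2) ∷ - (+ 3) ∷ []) ⊕ 2t-t²+t³ ⊗ A ⊕ tA+1 ⊗ B) n
    series-identity D D0 D1 D2 A0 A1 rec zero = trans D0 (sym
      (cong (λ z → + 0 ℤ.+ z) (trans (tA+1⊗B 0) (cong (ℤ._+ + 0) B0))))
    series-identity D D0 D1 D2 A0 A1 rec (suc zero) = trans D1 (sym (cong₂ ℤ._+_
      (cong (λ x → - (+ 2) ℤ.+ (+ 0 ℤ.+ (+ 2 ℤ.* x ℤ.+ + 0))) A0)
      (trans (tA+1⊗B 1) (cong₂ (λ x y → x ℤ.+ (y ℤ.+ + 0)) B1 (trans (cong (A 0 ℤ.*_) B0) (ℤₚ.*-zeroʳ (A 0)))))))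
    series-identity D D0 D1 D2 A0 A1 rec (suc (suc zero)) = trans D2 (sym (cong₂ ℤ._+_
      (cong₂ (λ x y → - (+ 3) ℤ.+ (+ 0 ℤ.+ (+ 2 ℤ.* x ℤ.+ (- (+ 1) ℤ.* y ℤ.+ + 0)))) A1 A0)
      (trans (tA+1⊗B 2) (trans (cong (ℤ._+ (A 0 ℤ.* B 1 ℤ.+ (A 1 ℤ.* B 0 ℤ.+ + 0))) B2)
        (cong₂ (λ x y → + 0 ℤ.+ (x ℤ.+ (y ℤ.+ + 0)))
          (trans (cong (A 0 ℤ.*_) B1) (ℤₚ.*-zeroʳ (A 0))) (trans (cong (A 1 ℤ.*_) B0) (ℤₚ.*-zeroʳ (A 1))))))))
    series-identity D D0 D1 D2 A0 A1 rec (suc (suc (suc m))) = trans (rec m) (sym (cong₂ ℤ._+_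
      (trans (ℤₚ.+-identityˡ _) ([2t-t²+t³]⊗A m))
      (trans (tA+1⊗B (3 + m)) (cong (λ z → B (3 + m) ℤ.+ z) (truncate m)))))

Dbarser-≥3 : ∀ {k} → 3 ≤ k → Dbarser k ≡ + dbar k
Dbarser-≥3 (s≤s (s≤s (s≤s _))) = refl

-- For `j < r` the bound `r ≤ m` makes the index `2 + m ∸ j` at least 3, and there `Dbarser` is
-- `dbar` rather than the default zero.
spanning-below-series : ∀ m r → r ≤ m →
  + spanning-below m r ≡ Dbarser (3 + m) ℤ.+ ∑< r (λ j → Aser j ℤ.* Dbarser (2 + m ∸ j))
spanning-below-series m zero _ = sym (ℤₚ.+-identityʳ _)
spanning-below-series m (suc r) r<m = begin
  + (spanning-below m r + dbar (2 + m ∸ r) * a r)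
    ≡⟨ ℤₚ.pos-+ (spanning-below m r) _ ⟩
  + spanning-below m r ℤ.+ + (dbar (2 + m ∸ r) * a r)
    ≡⟨ cong₂ ℤ._+_ (spanning-below-series m r (<⇒≤ r<m)) summand ⟩
  Dbarser (3 + m) ℤ.+ ∑< r f ℤ.+ f r
    ≡⟨ ℤₚ.+-assoc (Dbarser (3 + m)) (∑< r f) (f r) ⟩
  Dbarser (3 + m) ℤ.+ (∑< r f ℤ.+ f r)
    ≡⟨ cong (λ z → Dbarser (3 + m) ℤ.+ z) (sym (∑<-suc r f)) ⟩
  Dbarser (3 + m) ℤ.+ ∑< (suc r) f ∎
  where
  open ≡-Reasoning
  f : Series
  f j = Aser j ℤ.* Dbarser (2 + m ∸ j)
  summand : + (dbar (2 + m ∸ r) * a r) ≡ f r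
  summand = trans (cong (λ k → + k) (*-comm (dbar (2 + m ∸ r)) (a r))) (trans (ℤₚ.pos-* (a r) _)
    (cong (λ z → + a r ℤ.* z) (sym (Dbarser-≥3 (subst (3 ≤_) (sym (+-∸-assoc 3 r<m)) (m≤m+n 3 (m ∸ suc r)))))))

private
  transpose : ∀ p q r s t → p + q ≡ t + r + s + s → + p ≡ + 2 ℤ.* + s ℤ.- + q ℤ.+ + r ℤ.+ + t
  transpose p q r s t eq = begin
    + p                                                ≡⟨ add-subtract (+ p) (+ q) ⟩
    + p ℤ.+ + q ℤ.- + q                                ≡⟨ cong (λ z → z ℤ.- + q) (trans (sym (ℤₚ.pos-+ p q)) (cong (λ k → + k) eq)) ⟩
    + (t + r + s + s) ℤ.- + q                          ≡⟨ cong (λ z → z ℤ.- + q) distribute ⟩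
    + t ℤ.+ + r ℤ.+ + s ℤ.+ + s ℤ.- + q                ≡⟨ collect (+ q) (+ r) (+ s) (+ t) ⟩
    + 2 ℤ.* + s ℤ.- + q ℤ.+ + r ℤ.+ + t                ∎
    where
    open ≡-Reasoning
    distribute : + (t + r + s + s) ≡ + t ℤ.+ + r ℤ.+ + s ℤ.+ + s
    distribute = trans (ℤₚ.pos-+ (t + r + s) s) (cong (λ z → z ℤ.+ + s)
      (trans (ℤₚ.pos-+ (t + r) s) (cong (λ z → z ℤ.+ + s) (ℤₚ.pos-+ t r))))
    add-subtract : ∀ x y → x ≡ x ℤ.+ y ℤ.- y
    add-subtract = solve-∀
    collect : ∀ y z w v → v ℤ.+ z ℤ.+ w ℤ.+ w ℤ.- y ≡ + 2 ℤ.* w ℤ.- y ℤ.+ z ℤ.+ v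
    collect = solve-∀

theorem10p18 : ∀ n → Dser n ≡ (poly (+ 0 ∷ - (+ 2) ∷ - (+ 3) ∷ [])
    ⊕ poly (+ 0 ∷ + 2 ∷ - (+ 1) ∷ + 1 ∷ []) ⊗ Aser
    ⊕ (poly (+ 0 ∷ + 1 ∷ []) ⊗ Aser ⊕ poly (+ 1 ∷ [])) ⊗ Dbarser) n
-- `Dbarser` and `Dser` are zero below degree 3 by definition; the last two `refl` evaluate the
-- enumerations for `a 0 = 1` and `a 1 = 2`.
theorem10p18 = series-identity Aser Dbarser refl refl refl Dser refl refl refl refl refl λ m →
  trans (transpose (d (3 + m)) (a (1 + m)) (a m) (a (2 + m)) (spanning-below m m) (d-recurrence m))
    (cong (λ z → + 2 ℤ.* Aser (2 + m) ℤ.- Aser (1 + m) ℤ.+ Aser m ℤ.+ z) (spanning-below-series m m ≤-refl))
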